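{- For $k\ge 2$, let $T_{k,m}=(C_{2l})^{\square k}$ be the $k$-dimensional toroidal grid of side-length $m=2l$ for $l>3$, with $n=m^k$ vertices. Then $$\mathrm{rw}(T_{k,m})\;\ge\;\frac{e\ln 2}{5}\cdot\frac{m^{k-1}}{k}\;=\;\Omega\left(n^{1-1/k}\right).$$
   Context: $C_m$ is the cycle on $m$ vertices, and $H^{\square k}$ is the $k$-th Cartesian power of $H$: its vertices are $k$-tuples of vertices of $H$, two being adjacent iff they differ in exactly one coordinate and are adjacent in $H$ in that coordinate. Rank-width: for a graph $G=(V,E)$ and $X\subseteq V$, the cut-rank $\rho_G(X)$ is the $\mathbb F_2$-rank of the $0$-$1$ adjacency matrix with rows indexed by $X$ and columns by $V\setminus X$. A rank-decomposition is a pair $(T,L)$ with $T$ a tree with at least two nodes, all of degree 1 or 3, and $L$ a bijection from $V$ to the leaves of $T$; its width is the maximum over edges $e$ of $T$ of $\rho_G$ of the vertex set corresponding to one side of $T-e$. $\mathrm{rw}(G)$ is the minimum width of a rank-decomposition of $G$. -}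

module Defs where

open import Algebra.Bundles using (CommutativeRing)
import Algebra.Properties.CommutativeMonoid.Sum as Sum
open import Data.Bool.Base using (Bool; true; false; _∧_)
import Data.Bool.Properties as Bool
open import Data.Fin.Base using (Fin; zero; suc; toℕ; fromℕ<; finToFun)
import Data.Fin.Properties as Fin
open import Data.Fin.Subset using (Subset; Nonempty; _∈_; _⊆_; ∁; inside; outside)
  renaming (∣_∣ to card)
open import Data.Fin.Subset.Properties using (anySubset?; nonempty?; _⊆?_; _∈?_)
import Data.Integer.Base as ℤ
import Data.Integer.Properties as ℤ
open import Data.List.Base as List using (List; []; _∷_; [_]; _++_)
open import Data.List.Extrema.Nat using (max)
open import Data.List.Relation.Unary.Linked using (Linked)
open import Data.List.Relation.Unary.Unique.Propositional using (Unique)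
open import Data.Nat.Base as ℕ using (ℕ; zero; suc; _!; NonZero; z≤n; s≤s)
import Data.Nat.Properties as ℕ
open import Data.Nat.Solver using (module +-*-Solver)
open import Data.Product.Base using (Σ-syntax; ∃; ∃-syntax; _×_; _,_; proj₁; proj₂)
open import Data.Rational.Base as ℚ using (ℚ; 0ℚ; 1ℚ; mkℚ)
import Data.Rational.Properties as ℚ
import Data.Rational.Solver as ℚ-Solver
import Data.Rational.Unnormalised.Base as ℚᵘ
import Data.Rational.Unnormalised.Properties as ℚᵘ
open import Data.Sum.Base using (_⊎_; inj₁; inj₂; swap)
open import Data.Vec.Base using (tabulate; lookup; []; _∷_)
open import Function.Base using (_∘_)
open import Function.Bundles using (_⤖_; Bijection)
open import Level using (0ℓ)
open import Relation.Binary.Core using (Rel)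
open import Relation.Binary.Construct.Closure.ReflexiveTransitive using (Star; _◅_; _◅◅_)
open import Relation.Binary.Definitions using (Decidable; Symmetric; Irreflexive)
open import Relation.Binary.PropositionalEquality
  using (_≡_; _≢_; refl; sym; trans; cong; cong₂; subst; subst₂; module ≡-Reasoning)
open import Relation.Nullary using (Dec; yes; no; ¬_; contradiction)
open import Relation.Nullary.Decidable
  using (⌊_⌋; map′; ¬?; _×-dec_; _⊎-dec_; _→-dec_)

record Graph (n : ℕ) : Set₁ where
  field
    Adj    : Rel (Fin n) 0ℓ
    adj?   : Decidable Adj
    symm   : Symmetric Adj
    irrefl : Irreflexive _≡_ Adj

  neighbours : Fin n → Subset n
  neighbours u = tabulate (λ v → ⌊ adj? u v ⌋)

  degree : Fin n → ℕ
  degree u = card (neighbours u)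

open Graph public using (Adj; adj?; symm; irrefl; neighbours; degree)

-- The clause i ≢ j only excludes the loop that would appear for m = 1.
cycle : (m : ℕ) → Graph m
cycle m = record
  { Adj    = λ i j → i ≢ j × (Next i j ⊎ Next j i)
  ; adj?   = λ i j → ¬? (i Fin.≟ j) ×-dec (next? i j ⊎-dec next? j i)
  ; symm   = λ (i≢j , s) → (i≢j ∘ sym) , swap s
  ; irrefl = λ i≡j (i≢j , _) → i≢j i≡j
  }
  where
  Next : Rel (Fin m) 0ℓ
  Next i j = (suc (toℕ i) ≡ toℕ j) ⊎ (suc (toℕ i) ≡ m × toℕ j ≡ 0)

  next? : Decidable Next
  next? i j = (suc (toℕ i) ℕ.≟ toℕ j)
       ⊎-dec ((suc (toℕ i) ℕ.≟ m) ×-dec (toℕ j ℕ.≟ 0))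

-- A k-tuple over Fin n is encoded by its index in Fin (n ^ k); finToFun, which
-- is inverse to funToFin, returns the tuple of coordinates.
infixl 8 _^□_
_^□_ : ∀ {n} → Graph n → (k : ℕ) → Graph (n ℕ.^ k)
_^□_ {n} H k = record
  { Adj    = λ x y → ∃[ i ] At i (finToFun x) (finToFun y)
  ; adj?   = λ x y → Fin.any? (λ i → at? i (finToFun x) (finToFun y))
  ; symm   = λ (i , a , eq) → i , symm H a , λ j j≢i → sym (eq j j≢i)
  ; irrefl = λ { refl (i , a , _) → irrefl H refl a }
  }
  where
  At : Fin k → Rel (Fin k → Fin n) 0ℓ
  At i x y = Adj H (x i) (y i) × (∀ j → j ≢ i → x j ≡ y j)

  at? : ∀ i → Decidable (At i)
  at? i x y = adj? H (x i) (y i)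
       ×-dec Fin.all? (λ j → ¬? (j Fin.≟ i) →-dec (x j Fin.≟ y j))

torus : (k m : ℕ) → Graph (m ℕ.^ k)
torus k m = cycle m ^□ k

removeEdge : ∀ {n} → Graph n → (u v : Fin n) → Graph n
removeEdge {n} G u v = record
  { Adj    = λ x y → Adj G x y × ¬ Same x y
  ; adj?   = λ x y → adj? G x y ×-dec ¬? (same? x y)
  ; symm   = λ (a , ¬s) → symm G a , ¬s ∘ flipSame
  ; irrefl = λ eq (a , _) → irrefl G eq a
  }
  where
  Same : Rel (Fin n) 0ℓ
  Same x y = (x ≡ u × y ≡ v) ⊎ (x ≡ v × y ≡ u)

  same? : Decidable Same
  same? x y = ((x Fin.≟ u) ×-dec (y Fin.≟ v)) ⊎-dec ((x Fin.≟ v) ×-dec (y Fin.≟ u))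

  flipSame : ∀ {x y} → Same x y → Same y x
  flipSame (inj₁ (p , q)) = inj₂ (q , p)
  flipSame (inj₂ (p , q)) = inj₁ (q , p)

Reachable : ∀ {n} → Graph n → Rel (Fin n) 0ℓ
Reachable G = Star (Adj G)

-- Warshall's recursion: Via k p x y holds when y can be reached from x with all
-- intermediate vertices among the first k.
module _ {n} (G : Graph n) where
  private
    Via : ∀ k → k ℕ.≤ n → Rel (Fin n) 0ℓ
    Via zero    _ x y = x ≡ y ⊎ Adj G x y
    Via (suc k) p x y = Via k (ℕ.<⇒≤ p) x y
      ⊎ (Via k (ℕ.<⇒≤ p) x (fromℕ< p) × Via k (ℕ.<⇒≤ p) (fromℕ< p) y)

    via? : ∀ k p → Decidable (Via k p)
    via? zero    _ x y = (x Fin.≟ y) ⊎-dec adj? G x y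
    via? (suc k) p x y = via? k _ x y ⊎-dec (via? k _ x _ ×-dec via? k _ _ y)

    sound : ∀ k p {x y} → Via k p x y → Reachable G x y
    sound zero    _ (inj₁ refl)    = Star.ε
    sound zero    _ (inj₂ a)       = a ◅ Star.ε
    sound (suc k) p (inj₁ q)       = sound k _ q
    sound (suc k) p (inj₂ (q , r)) = sound k _ q ◅◅ sound k _ r

    reflexive : ∀ k p {x} → Via k p x x
    reflexive zero    _ = inj₁ refl
    reflexive (suc k) p = inj₁ (reflexive k _)

    edge : ∀ k p {x y} → Adj G x y → Via k p x y
    edge zero    _ a = inj₂ a
    edge (suc k) p a = inj₁ (edge k _ a)

    compose : ∀ k p {x y} z → toℕ z ℕ.< k → Via k p x z → Via k p z y → Via k p x y
    compose (suc k) p z z<k q r with toℕ z ℕ.≟ k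
    ... | yes z≡k = inj₂ (collapseʳ q , collapseˡ r)
      where
      z≡ : z ≡ fromℕ< p
      z≡ = Fin.toℕ-injective (trans z≡k (sym (Fin.toℕ-fromℕ< p)))
      collapseʳ : ∀ {x} → Via (suc k) p x z → Via k (ℕ.<⇒≤ p) x (fromℕ< p)
      collapseʳ (inj₁ s)       = subst (Via k _ _) z≡ s
      collapseʳ (inj₂ (s , _)) = s
      collapseˡ : ∀ {y} → Via (suc k) p z y → Via k (ℕ.<⇒≤ p) (fromℕ< p) y
      collapseˡ (inj₁ s)       = subst (λ w → Via k _ w _) z≡ s
      collapseˡ (inj₂ (_ , s)) = s
    ... | no z≢k = join q r
      where
      z<k′ : toℕ z ℕ.< k
      z<k′ = ℕ.≤∧≢⇒< (ℕ.s≤s⁻¹ z<k) z≢k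
      join : ∀ {x y} → Via (suc k) p x z → Via (suc k) p z y → Via (suc k) p x y
      join (inj₁ s)       (inj₁ t)       = inj₁ (compose k _ z z<k′ s t)
      join (inj₁ s)       (inj₂ (t , u)) = inj₂ (compose k _ z z<k′ s t , u)
      join (inj₂ (s , t)) (inj₁ u)       = inj₂ (s , compose k _ z z<k′ t u)
      join (inj₂ (s , _)) (inj₂ (_ , u)) = inj₂ (s , u)

    complete : ∀ {x y} → Reachable G x y → Via n ℕ.≤-refl x y
    complete Star.ε  = reflexive n _
    complete (a ◅ r) = compose n _ _ (Fin.toℕ<n _) (edge n _ a) (complete r)

  reachable? : Decidable (Reachable G)
  reachable? x y = map′ (sound n ℕ.≤-refl) complete (via? n ℕ.≤-refl x y)

Connected : ∀ {n} → Graph n → Set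
Connected G = ∀ u v → Reachable G u v

-- v ∷ vs lists the vertices of a cycle in order, starting at v.
IsCycle : ∀ {n} → Graph n → Fin n → List (Fin n) → Set
IsCycle G v vs = 2 ℕ.≤ List.length vs
               × Unique (v ∷ vs)
               × Linked (Adj G) (v ∷ vs ++ [ v ])

Acyclic : ∀ {n} → Graph n → Set
Acyclic G = ∀ v vs → ¬ IsCycle G v vs

record IsTree {n} (G : Graph n) : Set where
  field
    nonempty  : NonZero n
    connected : Connected G
    acyclic   : Acyclic G

-- 𝔽₂ is Bool with _xor_ as addition and _∧_ as multiplication.
𝔽₂ : CommutativeRing 0ℓ 0ℓ
𝔽₂ = Bool.xor-∧-commutativeRing

open Sum (CommutativeRing.+-commutativeMonoid 𝔽₂) using (sum)

Matrix : ℕ → ℕ → Set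
Matrix p q = Fin p → Fin q → Bool

module _ {p q} (M : Matrix p q) where

  -- A coefficient vector over 𝔽₂ is the same thing as a set of rows.
  combination : Subset p → Fin q → Bool
  combination c j = sum (λ i → lookup c i ∧ M i j)

  Dependent : Subset q → Subset p → Set
  Dependent C S = ∃[ c ] Nonempty c × c ⊆ S × (∀ j → j ∈ C → combination c j ≡ false)

  dependent? : ∀ C S → Dec (Dependent C S)
  dependent? C S = anySubset? λ c →
    nonempty? c ×-dec c ⊆? S ×-dec
    Fin.all? (λ j → (j ∈? C) →-dec (combination c j Bool.≟ false))

  Independent : Subset q → Subset p → Set
  Independent C S = ¬ Dependent C S

allSubsets : ∀ n → List (Subset n)
allSubsets zero    = [ [] ]
allSubsets (suc n) = List.map (outside ∷_) (allSubsets n) ++ List.map (inside ∷_) (allSubsets n)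

-- The rank of the submatrix of M with rows R and columns C: the largest number
-- of linearly independent rows.
rank : ∀ {p q} → Matrix p q → Subset p → Subset q → ℕ
rank {p} M R C = max 0 (List.map card (List.filter good? (allSubsets p)))
  where
  good? : ∀ S → Dec (S ⊆ R × Independent M C S)
  good? S = S ⊆? R ×-dec ¬? (dependent? M C S)

adjacencyMatrix : ∀ {n} → Graph n → Matrix n n
adjacencyMatrix G u v = ⌊ adj? G u v ⌋

cutRank : ∀ {n} → Graph n → Subset n → ℕ
cutRank G X = rank (adjacencyMatrix G) X (∁ X)

Leaf : ∀ {n} → Graph n → Set
Leaf T = ∃[ t ] degree T t ≡ 1

record RankDecomposition {n} (G : Graph n) : Set₁ where
  field
    {nodes}  : ℕ
    tree     : Graph nodes
    isTree   : IsTree tree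
    2≤nodes  : 2 ℕ.≤ nodes
    subcubic : ∀ t → degree tree t ≡ 1 ⊎ degree tree t ≡ 3
    leaves   : Fin n ⤖ Leaf tree

  leaf : Fin n → Fin nodes
  leaf x = proj₁ (Bijection.to leaves x)

  -- The vertices of G whose leaf lies in the component of s in tree − st.
  side : Fin nodes × Fin nodes → Subset n
  side (s , t) = tabulate (λ x → ⌊ reachable? (removeEdge tree s t) s (leaf x) ⌋)

  -- Every edge is listed in both orientations, hence with both of its sides.
  edges : List (Fin nodes × Fin nodes)
  edges = List.filter (λ (s , t) → adj? tree s t)
                      (List.cartesianProduct (List.allFin nodes) (List.allFin nodes))

  width : ℕ
  width = max 0 (List.map (cutRank G ∘ side) edges)

open RankDecomposition public using (width)

-- r is rw(G).
IsRankWidth : ∀ {n} → Graph n → ℕ → Set₁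
IsRankWidth G r = (Σ[ D ∈ RankDecomposition G ] width D ≡ r)
                × (∀ (D : RankDecomposition G) → r ℕ.≤ width D)

-- Real numbers are Cauchy sequences of rationals; two sequences are equal as
-- reals when each is ≤ᴿ the other.
Cauchy : (ℕ → ℚ) → Set
Cauchy x = ∀ ε → 0ℚ ℚ.< ε →
           ∃[ N ] ∀ i j → N ℕ.≤ i → N ℕ.≤ j → ℚ.∣ x i ℚ.- x j ∣ ℚ.≤ ε

record ℝ : Set where
  field
    seq    : ℕ → ℚ
    cauchy : Cauchy seq

open ℝ public

infix 4 _≤ᴿ_
_≤ᴿ_ : Rel ℝ 0ℓ
x ≤ᴿ y = ∀ ε → 0ℚ ℚ.< ε → ∃[ N ] ∀ i → N ℕ.≤ i → seq x i ℚ.≤ seq y i ℚ.+ ε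

fromℚ : ℚ → ℝ
fromℚ q = record
  { seq    = λ _ → q
  ; cauchy = λ ε ε>0 → 0 , λ _ _ _ _ →
      subst (ℚ._≤ ε) (sym (cong ℚ.∣_∣ (ℚ.+-inverseʳ q))) (ℚ.<⇒≤ ε>0)
  }

fromℕ : ℕ → ℝ
fromℕ n = fromℚ (ℤ.+ n ℚ./ 1)

private module Identities where
  open import Data.Rational.Base using (_+_; _-_; _*_)
  open ℚ-Solver.+-*-Solver

  recentre : ∀ a b → a ≡ b + (a - b)
  recentre = solve 2 (λ a b → a := b :+ (a :- b)) refl

  recentre₂ : ∀ a b c → a - b ≡ (a - c) - (b - c)
  recentre₂ = solve 3 (λ a b c → a :- b := (a :- c) :- (b :- c)) refl

  cancel : ∀ a b → (a + b) - a ≡ b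
  cancel = solve 2 (λ a b → (a :+ b) :- a := b) refl

  split : ∀ a b c d → a * b - c * d ≡ a * (b - d) + (a - c) * d
  split = solve 4 (λ a b c d → a :* b :- c :* d := a :* (b :- d) :+ (a :- c) :* d) refl

  factor : ∀ a b e d → a * (e * d) + (e * d) * b ≡ e * ((a + b) * d)
  factor = solve 4 (λ a b e d → a :* (e :* d) :+ (e :* d) :* b := e :* ((a :+ b) :* d)) refl

open Identities

module _ where
  open import Data.Rational.Base using (_+_; _-_; _*_; ∣_∣; _≤_; _<_)
  open ℚ.≤-Reasoning

  private
    bound : ∀ {x} → Cauchy x → ∃[ B ] 0ℚ < B × ∃[ N ] ∀ i → N ℕ.≤ i → ∣ x i ∣ ≤ B
    bound {x} cx with cx 1ℚ (ℚ.positive⁻¹ 1ℚ)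
    ... | N , close = ∣ x N ∣ + 1ℚ
        , ℚ.+-mono-≤-< (ℚ.0≤∣p∣ (x N)) (ℚ.positive⁻¹ 1ℚ)
        , N , λ i N≤i → begin
            ∣ x i ∣               ≡⟨ cong ∣_∣ (recentre (x i) (x N)) ⟩
            ∣ x N + (x i - x N) ∣ ≤⟨ ℚ.∣p+q∣≤∣p∣+∣q∣ (x N) _ ⟩
            ∣ x N ∣ + ∣ x i - x N ∣ ≤⟨ ℚ.+-monoʳ-≤ ∣ x N ∣ (close i N N≤i ℕ.≤-refl) ⟩
            ∣ x N ∣ + 1ℚ          ∎

    *-mono : ∀ {a b c d} → 0ℚ ≤ b → 0ℚ ≤ c → a ≤ b → c ≤ d → a * c ≤ b * d
    *-mono {a} {b} {c} {d} 0≤b 0≤c a≤b c≤d = ℚ.≤-trans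
      (ℚ.*-monoʳ-≤-nonNeg c {{ℚ.nonNegative 0≤c}} a≤b)
      (ℚ.*-monoˡ-≤-nonNeg b {{ℚ.nonNegative 0≤b}} c≤d)

    *-pos : ∀ {a b} → 0ℚ < a → 0ℚ < b → 0ℚ < a * b
    *-pos {a} {b} 0<a 0<b =
      ℚ.positive⁻¹ (a * b) {{ℚ.pos*pos⇒pos a {{ℚ.positive 0<a}} b {{ℚ.positive 0<b}}}}

    product-close : ∀ {a b c d A B δ} → 0ℚ ≤ A → 0ℚ ≤ δ → ∣ a ∣ ≤ A → ∣ d ∣ ≤ B →
                    ∣ b - d ∣ ≤ δ → ∣ a - c ∣ ≤ δ → ∣ a * b - c * d ∣ ≤ A * δ + δ * B
    product-close {a} {b} {c} {d} {A} {B} {δ} 0≤A 0≤δ a≤A d≤B b~d a~c = begin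
      ∣ a * b - c * d ∣                         ≡⟨ cong ∣_∣ (split a b c d) ⟩
      ∣ a * (b - d) + (a - c) * d ∣             ≤⟨ ℚ.∣p+q∣≤∣p∣+∣q∣ (a * (b - d)) ((a - c) * d) ⟩
      ∣ a * (b - d) ∣ + ∣ (a - c) * d ∣         ≡⟨ cong₂ _+_ (ℚ.∣p*q∣≡∣p∣*∣q∣ a (b - d)) (ℚ.∣p*q∣≡∣p∣*∣q∣ (a - c) d) ⟩
      ∣ a ∣ * ∣ b - d ∣ + ∣ a - c ∣ * ∣ d ∣     ≤⟨ ℚ.+-mono-≤ (*-mono 0≤A (ℚ.0≤∣p∣ (b - d)) a≤A b~d)
                                                             (*-mono 0≤δ (ℚ.0≤∣p∣ d) a~c d≤B) ⟩
      A * δ + δ * B                             ∎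

    tolerance : ∀ {A B ε} → 0ℚ < A → 0ℚ < B → 0ℚ < ε → ∃[ δ ] 0ℚ < δ × A * δ + δ * B ≡ ε
    tolerance {A} {B} {ε} A>0 B>0 ε>0 = go (A + B) refl (ℚ.+-mono-< A>0 B>0)
      where
      go : ∀ D → A + B ≡ D → 0ℚ < D → ∃[ δ ] 0ℚ < δ × A * δ + δ * B ≡ ε
      go D eq D>0 = ε * 1/D , *-pos ε>0 1/D>0 , (begin-equality
        A * (ε * 1/D) + (ε * 1/D) * B ≡⟨ factor A B ε 1/D ⟩
        ε * ((A + B) * 1/D)           ≡⟨ cong (λ C → ε * (C * 1/D)) eq ⟩
        ε * (D * 1/D)                 ≡⟨ cong (ε *_) (ℚ.*-inverseʳ D {{ℚ.>-nonZero D>0}}) ⟩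
        ε * 1ℚ                        ≡⟨ ℚ.*-identityʳ ε ⟩
        ε                             ∎)
        where
        1/D = (ℚ.1/ D) {{ℚ.>-nonZero D>0}}
        1/D>0 : 0ℚ < 1/D
        1/D>0 = ℚ.positive⁻¹ 1/D {{ℚ.1/pos⇒pos D {{ℚ.positive D>0}}}}

    *-cauchy : ∀ {x y} → Cauchy x → Cauchy y → Cauchy (λ i → x i * y i)
    *-cauchy {x} {y} cx cy ε ε>0 = from-bounds (bound {x} cx) (bound {y} cy)
      where
      Close : (ℕ → ℚ) → ℚ → Set
      Close z δ = ∃[ N ] ∀ i j → N ℕ.≤ i → N ℕ.≤ j → ∣ z i - z j ∣ ≤ δ

      Bounded : (ℕ → ℚ) → ℚ → Set
      Bounded z B = ∃[ N ] ∀ i → N ℕ.≤ i → ∣ z i ∣ ≤ B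

      combine : ∀ A B δ → 0ℚ < A → 0ℚ < δ → A * δ + δ * B ≡ ε →
                Bounded x A → Bounded y B → Close x δ → Close y δ → Close (λ i → x i * y i) ε
      combine A B δ A>0 δ>0 scale (N₁ , x≤A) (N₂ , y≤B) (N₃ , x~) (N₄ , y~) =
        (N₁ ℕ.⊔ N₂) ℕ.⊔ (N₃ ℕ.⊔ N₄) , λ i j p q →
          subst (∣ x i * y i - x j * y j ∣ ≤_) scale
            (product-close {x i} {y i} {x j} {y j} {A} {B} {δ} (ℚ.<⇒≤ A>0) (ℚ.<⇒≤ δ>0)
              (x≤A i (ℕ.m⊔n≤o⇒m≤o N₁ N₂ (left p)))
              (y≤B j (ℕ.m⊔n≤o⇒n≤o N₁ N₂ (left q)))
              (y~ i j (ℕ.m⊔n≤o⇒n≤o N₃ N₄ (right p)) (ℕ.m⊔n≤o⇒n≤o N₃ N₄ (right q)))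
              (x~ i j (ℕ.m⊔n≤o⇒m≤o N₃ N₄ (right p)) (ℕ.m⊔n≤o⇒m≤o N₃ N₄ (right q))))
        where
        left : ∀ {i} → (N₁ ℕ.⊔ N₂) ℕ.⊔ (N₃ ℕ.⊔ N₄) ℕ.≤ i → N₁ ℕ.⊔ N₂ ℕ.≤ i
        left = ℕ.m⊔n≤o⇒m≤o (N₁ ℕ.⊔ N₂) (N₃ ℕ.⊔ N₄)
        right : ∀ {i} → (N₁ ℕ.⊔ N₂) ℕ.⊔ (N₃ ℕ.⊔ N₄) ℕ.≤ i → N₃ ℕ.⊔ N₄ ℕ.≤ i
        right = ℕ.m⊔n≤o⇒n≤o (N₁ ℕ.⊔ N₂) (N₃ ℕ.⊔ N₄)

      from-tolerance : ∀ A B → 0ℚ < A → Bounded x A → Bounded y B →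
                       (∃[ δ ] 0ℚ < δ × A * δ + δ * B ≡ ε) → Close (λ i → x i * y i) ε
      from-tolerance A B A>0 bx by (δ , δ>0 , scale) =
        combine A B δ A>0 δ>0 scale bx by (cx δ δ>0) (cy δ δ>0)

      from-bounds : (∃[ A ] 0ℚ < A × Bounded x A) → (∃[ B ] 0ℚ < B × Bounded y B) →
                    Close (λ i → x i * y i) ε
      from-bounds (A , A>0 , bx) (B , B>0 , by) =
        from-tolerance A B A>0 bx by (tolerance {A} {B} {ε} A>0 B>0 ε>0)

  infixl 7 _*ᴿ_
  _*ᴿ_ : ℝ → ℝ → ℝ
  x *ᴿ y = record
    { seq    = λ i → seq x i * seq y i
    ; cauchy = *-cauchy {seq x} {seq y} (cauchy x) (cauchy y)
    }

2^ : ℕ → ℕ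
2^ n = 2 ℕ.^ n

2^≢0 : ∀ n → NonZero (2^ n)
2^≢0 n = ℕ.m^n≢0 2 n

infix 8 _/2^_
_/2^_ : ℕ → ℕ → ℚ
a /2^ n = (ℤ.+ a ℚ./ 2^ n) {{2^≢0 n}}

module _ where
  open import Data.Rational.Base using (_+_; _-_; -_; _*_; ∣_∣; _≤_; _<_; _/_)

  /-mono : ∀ {a c} b d .{{_ : NonZero b}} .{{_ : NonZero d}} →
           a ℕ.* d ℕ.≤ c ℕ.* b → ℤ.+ a / b ≤ ℤ.+ c / d
  /-mono {a} {c} b@(suc _) d@(suc _) le = ℚ.toℚᵘ-cancel-≤ (begin
    ℚ.toℚᵘ (ℤ.+ a / b) ≃⟨ ℚ.toℚᵘ-fromℚᵘ (ℤ.+ a ℚᵘ./ b) ⟩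
    ℤ.+ a ℚᵘ./ b       ≤⟨ ℚᵘ.*≤* (subst₂ ℤ._≤_ (ℤ.pos-* a d) (ℤ.pos-* c b) (ℤ.+≤+ le)) ⟩
    ℤ.+ c ℚᵘ./ d       ≃⟨ ℚᵘ.≃-sym (ℚ.toℚᵘ-fromℚᵘ (ℤ.+ c ℚᵘ./ d)) ⟩
    ℚ.toℚᵘ (ℤ.+ c / d) ∎)
    where open ℚᵘ.≤-Reasoning

  /-+ : ∀ a c d .{{_ : NonZero d}} → ℤ.+ a / d + ℤ.+ c / d ≡ ℤ.+ (a ℕ.+ c) / d
  /-+ a c d@(suc _) = ℚ.toℚᵘ-injective (begin
    ℚ.toℚᵘ (ℤ.+ a / d + ℤ.+ c / d)          ≈⟨ ℚ.toℚᵘ-homo-+ (ℤ.+ a / d) _ ⟩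
    ℚ.toℚᵘ (ℤ.+ a / d) ℚᵘ.+ ℚ.toℚᵘ (ℤ.+ c / d)
      ≈⟨ ℚᵘ.+-cong (ℚ.toℚᵘ-fromℚᵘ (ℤ.+ a ℚᵘ./ d)) (ℚ.toℚᵘ-fromℚᵘ (ℤ.+ c ℚᵘ./ d)) ⟩
    ℤ.+ a ℚᵘ./ d ℚᵘ.+ ℤ.+ c ℚᵘ./ d          ≈⟨ ℚᵘ.*≡* eq ⟩
    ℤ.+ (a ℕ.+ c) ℚᵘ./ d                    ≈⟨ ℚᵘ.≃-sym (ℚ.toℚᵘ-fromℚᵘ (ℤ.+ (a ℕ.+ c) ℚᵘ./ d)) ⟩
    ℚ.toℚᵘ (ℤ.+ (a ℕ.+ c) / d)              ∎)
    where
    open import Relation.Binary.Reasoning.Setoid ℚᵘ.≃-setoid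
    eq : (ℤ.+ a ℤ.* ℤ.+ d ℤ.+ ℤ.+ c ℤ.* ℤ.+ d) ℤ.* ℤ.+ d ≡ ℤ.+ (a ℕ.+ c) ℤ.* ℤ.+ (d ℕ.* d)
    eq = trans (cong (ℤ._* ℤ.+ d) (sym (ℤ.*-distribʳ-+ (ℤ.+ d) (ℤ.+ a) (ℤ.+ c))))
        (trans (ℤ.*-assoc (ℤ.+ (a ℕ.+ c)) (ℤ.+ d) (ℤ.+ d))
               (cong (ℤ.+ (a ℕ.+ c) ℤ.*_) (sym (ℤ.pos-* d d))))

  /-nonNeg : ∀ a b .{{_ : NonZero b}} → 0ℚ ≤ ℤ.+ a / b
  /-nonNeg a b = /-mono {0} {a} 1 b z≤n

  dyadic-mono : ∀ {a c} m n → a ℕ.* 2^ n ℕ.≤ c ℕ.* 2^ m → a /2^ m ≤ c /2^ n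
  dyadic-mono {a} {c} m n = /-mono {a} {c} (2^ m) (2^ n) {{2^≢0 m}} {{2^≢0 n}}

  dyadic-+ : ∀ a c n → a /2^ n + c /2^ n ≡ (a ℕ.+ c) /2^ n
  dyadic-+ a c n = /-+ a c (2^ n) {{2^≢0 n}}

  n<2^n : ∀ n → n ℕ.< 2^ n
  n<2^n zero    = s≤s z≤n
  n<2^n (suc n) = begin-strict
    suc n             ≡⟨ ℕ.+-comm 1 n ⟩
    n ℕ.+ 1           <⟨ ℕ.+-mono-<-≤ (n<2^n n) (ℕ.m^n>0 2 n) ⟩
    2^ n ℕ.+ 2^ n     ≡⟨ cong (2^ n ℕ.+_) (sym (ℕ.+-identityʳ _)) ⟩
    2^ (suc n)        ∎
    where open ℕ.≤-Reasoning

  -- For rational ε > 0 the denominator q of ε satisfies 8 / 2^(3+q) ≤ 1/q ≤ ε.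
  small : ∀ ε → 0ℚ < ε → ∃[ N ] 8 /2^ N ≤ ε
  small ε@(mkℚ (ℤ.+ zero) d-1 _) 0<ε =
    contradiction (ℚ.positive 0<ε) λ { () }
  small ε@(mkℚ ℤ.-[1+ _ ] d-1 _) 0<ε =
    contradiction (ℚ.positive 0<ε) λ { () }
  small ε@(mkℚ (ℤ.+ a@(suc a-1)) d-1 _) _ = N , subst (8 /2^ N ≤_) (ℚ.↥p/↧p≡p ε)
    (/-mono {8} {a} (2^ N) q {{2^≢0 N}} (begin
      8 ℕ.* q                 ≤⟨ ℕ.*-monoʳ-≤ 8 (ℕ.<⇒≤ (n<2^n q)) ⟩
      8 ℕ.* 2^ q              ≡⟨ sym (ℕ.^-distribˡ-+-* 2 3 q) ⟩
      2^ N                    ≤⟨ ℕ.m≤n*m (2^ N) a ⟩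
      a ℕ.* 2^ N              ∎))
    where
    q = suc d-1
    N = 3 ℕ.+ q
    open ℕ.≤-Reasoning

  -- A sequence with x (i+1) - x i ∈ [0, 2/2^i] is Cauchy.
  geometric : ∀ x → (∀ i → x i ≤ x (suc i)) → (∀ i → x (suc i) ≤ x i + 2 /2^ i) → Cauchy x
  geometric x up step ε ε>0 = N , λ i j p q → begin
      ∣ x i - x j ∣                 ≡⟨ cong ∣_∣ (recentre₂ (x i) (x j) (x N)) ⟩
      ∣ (x i - x N) - (x j - x N) ∣ ≤⟨ ℚ.∣p-q∣≤∣p∣+∣q∣ (x i - x N) (x j - x N) ⟩
      ∣ x i - x N ∣ + ∣ x j - x N ∣ ≤⟨ ℚ.+-mono-≤ (near i p) (near j q) ⟩
      4 /2^ N + 4 /2^ N   ≡⟨ dyadic-+ 4 4 N ⟩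
      8 /2^ N                  ≤⟨ 8/2^N≤ε ⟩
      ε                             ∎
    where
    open ℚ.≤-Reasoning
    N = proj₁ (small ε ε>0)
    8/2^N≤ε = proj₂ (small ε ε>0)
    above : ∀ d → x N ≤ x (d ℕ.+ N)
    above zero    = ℚ.≤-refl
    above (suc d) = ℚ.≤-trans (above d) (up (d ℕ.+ N))
    below : ∀ d → x (d ℕ.+ N) + 4 /2^ (d ℕ.+ N) ≤ x N + 4 /2^ N
    below zero    = ℚ.≤-refl
    below (suc d) = begin
      x (suc M) + 4 /2^ (suc M)                  ≤⟨ ℚ.+-mono-≤ (step M) (dyadic-mono {4} {2} (suc M) M halve) ⟩
      (x M + 2 /2^ M) + 2 /2^ M             ≡⟨ ℚ.+-assoc (x M) _ _ ⟩
      x M + (2 /2^ M + 2 /2^ M)             ≡⟨ cong (x M +_) (dyadic-+ 2 2 M) ⟩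
      x M + 4 /2^ M                              ≤⟨ below d ⟩
      x N + 4 /2^ N                              ∎
      where
      M = d ℕ.+ N
      halve : 4 ℕ.* 2^ M ℕ.≤ 2 ℕ.* 2^ (suc M)
      halve = ℕ.≤-reflexive (ℕ.*-assoc 2 2 (2^ M))
    near′ : ∀ d → ∣ x (d ℕ.+ N) - x N ∣ ≤ 4 /2^ N
    near′ d = begin
      ∣ x M - x N ∣ ≡⟨ ℚ.0≤p⇒∣p∣≡p (subst (_≤ x M - x N) (ℚ.+-inverseʳ (x N)) (ℚ.+-monoˡ-≤ (- x N) (above d))) ⟩
      x M - x N     ≡⟨ cong (_- x N) (sym (ℚ.+-identityʳ (x M))) ⟩
      (x M + 0ℚ) - x N ≤⟨ ℚ.+-monoˡ-≤ (- x N) (ℚ.+-monoʳ-≤ (x M) (/-nonNeg 4 (2^ M) {{2^≢0 M}})) ⟩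
      (x M + 4 /2^ M) - x N ≤⟨ ℚ.+-monoˡ-≤ (- x N) (below d) ⟩
      (x N + 4 /2^ N) - x N ≡⟨ cancel (x N) (4 /2^ N) ⟩
      4 /2^ N  ∎
      where M = d ℕ.+ N
    near : ∀ i → N ℕ.≤ i → ∣ x i - x N ∣ ≤ 4 /2^ N
    near i N≤i = subst (λ k → ∣ x k - x N ∣ ≤ 4 /2^ N) (ℕ.m∸n+n≡m N≤i) (near′ (i ℕ.∸ N))

  partialSum : (ℕ → ℚ) → ℕ → ℚ
  partialSum t zero    = 0ℚ
  partialSum t (suc n) = partialSum t n + t n

  series : (t : ℕ → ℚ) → (∀ i → 0ℚ ≤ t i) → (∀ i → t i ≤ 2 /2^ i) → ℝ
  series t 0≤t t≤ = record
    { seq    = partialSum t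
    ; cauchy = geometric (partialSum t)
        (λ i → subst (_≤ partialSum t i + t i) (ℚ.+-identityʳ _) (ℚ.+-monoʳ-≤ (partialSum t i) (0≤t i)))
        (λ i → ℚ.+-monoʳ-≤ (partialSum t i) (t≤ i))
    }

  private
    2^≤2*! : ∀ i → 2^ i ℕ.≤ 2 ℕ.* i !
    2^≤2*! zero          = s≤s z≤n
    2^≤2*! (suc zero)    = ℕ.≤-refl
    2^≤2*! (suc (suc i)) = begin
      2 ℕ.* 2^ (suc i)                ≤⟨ ℕ.*-mono-≤ (s≤s (s≤s (z≤n {i}))) (2^≤2*! (suc i)) ⟩
      suc (suc i) ℕ.* (2 ℕ.* suc i !) ≡⟨ x∙yz≈y∙xz (suc (suc i)) 2 (suc i !) ⟩
      2 ℕ.* suc (suc i) !             ∎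
      where
      open ℕ.≤-Reasoning
      open import Algebra.Properties.CommutativeSemigroup ℕ.*-commutativeSemigroup using (x∙yz≈y∙xz)

  -- e = Σ_{i ≥ 0} 1 / i!
  e : ℝ
  e = series (λ i → (ℤ.+ 1 / (i !)) {{i ℕ.!≢0}})
        (λ i → /-nonNeg 1 (i !) {{i ℕ.!≢0}})
        (λ i → /-mono {1} {2} (i !) (2^ i) {{i ℕ.!≢0}} {{2^≢0 i}}
          (ℕ.≤-trans (ℕ.≤-reflexive (ℕ.*-identityˡ _)) (2^≤2*! i)))

  -- ln 2 = - ln (1 - 1/2) = Σ_{i ≥ 1} 1 / (i 2ⁱ)
  ln2 : ℝ
  ln2 = series (λ i → (ℤ.+ 1 / d i) {{d≢0 i}})
          (λ i → /-nonNeg 1 (d i) {{d≢0 i}})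
          (λ i → /-mono {1} {2} (d i) (2^ i) {{d≢0 i}} {{2^≢0 i}} (begin
            1 ℕ.* 2^ i                         ≡⟨ ℕ.*-identityˡ (2^ i) ⟩
            2^ i                               ≤⟨ ℕ.^-monoʳ-≤ 2 (ℕ.n≤1+n i) ⟩
            2^ (suc i)                         ≤⟨ ℕ.m≤n*m (2^ (suc i)) (suc i) ⟩
            d i                                ≤⟨ ℕ.m≤n*m (d i) 2 ⟩
            2 ℕ.* d i                          ∎))
    where
    open ℕ.≤-Reasoning
    d : ℕ → ℕ
    d i = suc i ℕ.* 2^ (suc i)
    d≢0 : ∀ i → NonZero (d i)
    d≢0 i = ℕ.m*n≢0 (suc i) (2^ (suc i)) {{_}} {{2^≢0 (suc i)}}

-- The largest a ≤ b with a ^ q ≤ N.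
rootBelow : (q N b : ℕ) → ℕ
rootBelow q N zero    = 0
rootBelow q N (suc b) with suc b ℕ.^ q ℕ.≤? N
... | yes _ = suc b
... | no  _ = rootBelow q N b

⌊root⌋ : (q N : ℕ) → ℕ
⌊root⌋ q N = rootBelow q N N

rootBelow-sound : ∀ q .{{_ : NonZero q}} N b → rootBelow q N b ℕ.^ q ℕ.≤ N
rootBelow-sound (suc _) N zero    = z≤n
rootBelow-sound q       N (suc b) with suc b ℕ.^ q ℕ.≤? N
... | yes p = p
... | no  _ = rootBelow-sound q N b

rootBelow-max : ∀ q N b a → a ℕ.≤ b → a ℕ.^ q ℕ.≤ N → a ℕ.≤ rootBelow q N b
rootBelow-max q N zero    a a≤b _ = a≤b
rootBelow-max q N (suc b) a a≤b p with suc b ℕ.^ q ℕ.≤? N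
... | yes _ = a≤b
... | no ¬p with a ℕ.≟ suc b
...   | yes refl = contradiction p ¬p
...   | no a≢    = rootBelow-max q N b a (ℕ.s≤s⁻¹ (ℕ.≤∧≢⇒< a≤b a≢)) p

^-distrib-* : ∀ q a b → (a ℕ.* b) ℕ.^ q ≡ a ℕ.^ q ℕ.* b ℕ.^ q
^-distrib-* zero    a b = refl
^-distrib-* (suc q) a b = trans (cong (a ℕ.* b ℕ.*_) (^-distrib-* q a b))
  (solve 4 (λ a b c d → a :* b :* (c :* d) := a :* c :* (b :* d)) refl a b (a ℕ.^ q) (b ℕ.^ q))
  where open +-*-Solver

a≤a^q : ∀ a q .{{_ : NonZero q}} → a ℕ.≤ a ℕ.^ q
a≤a^q zero      q       = z≤n
a≤a^q a@(suc _) (suc q) = ℕ.m≤m*n a (a ℕ.^ q) {{ℕ.m^n≢0 a q}}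

⌊root⌋-max : ∀ q .{{_ : NonZero q}} N a → a ℕ.^ q ℕ.≤ N → a ℕ.≤ ⌊root⌋ q N
⌊root⌋-max q N a p = rootBelow-max q N N a (ℕ.≤-trans (a≤a^q a q) p) p

-- The q-th root of N, approximated by ⌊ (N · 2^(jq))^(1/q) ⌋ / 2^j.
root : (q : ℕ) .{{_ : NonZero q}} → ℕ → ℝ
root q N = record
  { seq    = λ j → r j /2^ j
  ; cauchy = geometric (λ j → r j /2^ j) up step
  }
  where
  scaled : ℕ → ℕ
  scaled j = N ℕ.* 2^ j ℕ.^ q

  r : ℕ → ℕ
  r j = ⌊root⌋ q (scaled j)

  scaled-suc : ∀ j → scaled (suc j) ≡ 2^ q ℕ.* scaled j
  scaled-suc j = begin
    N ℕ.* (2 ℕ.* 2^ j) ℕ.^ q      ≡⟨ cong (N ℕ.*_) (^-distrib-* q 2 (2^ j)) ⟩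
    N ℕ.* (2^ q ℕ.* 2^ j ℕ.^ q)   ≡⟨ solve 3 (λ a b c → a :* (b :* c) := b :* (a :* c)) refl N (2^ q) (2^ j ℕ.^ q) ⟩
    2^ q ℕ.* scaled j             ∎
    where open ≡-Reasoning
          open +-*-Solver

  double : ∀ a j → a ℕ.^ q ℕ.≤ scaled j → (2 ℕ.* a) ℕ.^ q ℕ.≤ scaled (suc j)
  double a j p = subst₂ ℕ._≤_ (sym (^-distrib-* q 2 a)) (sym (scaled-suc j)) (ℕ.*-monoʳ-≤ (2^ q) p)

  halve : ∀ a j → (2 ℕ.* a) ℕ.^ q ℕ.≤ scaled (suc j) → a ℕ.^ q ℕ.≤ scaled j
  halve a j p = ℕ.*-cancelˡ-≤ (2^ q) {{2^≢0 q}} (subst₂ ℕ._≤_ (^-distrib-* q 2 a) (scaled-suc j) p)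

  lower : ∀ j → 2 ℕ.* r j ℕ.≤ r (suc j)
  lower j = ⌊root⌋-max q _ _ (double (r j) j (rootBelow-sound q (scaled j) (scaled j)))

  upper : ∀ j → r (suc j) ℕ.≤ 2 ℕ.* suc (r j)
  upper j = ℕ.≮⇒≥ λ lt → ℕ.<-irrefl refl
    (⌊root⌋-max q (scaled j) (suc (r j)) (halve _ j
      (ℕ.≤-trans (ℕ.^-monoˡ-≤ q (ℕ.<⇒≤ lt)) (rootBelow-sound q (scaled (suc j)) (scaled (suc j))))))

  up : ∀ j → r j /2^ j ℚ.≤ r (suc j) /2^ (suc j)
  up j = dyadic-mono {r j} {r (suc j)} j (suc j) (begin
    r j ℕ.* (2 ℕ.* 2^ j)   ≡⟨ solve 2 (λ a b → a :* (con 2 :* b) := (con 2 :* a) :* b) refl (r j) (2^ j) ⟩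
    (2 ℕ.* r j) ℕ.* 2^ j   ≤⟨ ℕ.*-monoˡ-≤ (2^ j) (lower j) ⟩
    r (suc j) ℕ.* 2^ j     ∎)
    where open ℕ.≤-Reasoning
          open +-*-Solver

  step : ∀ j → r (suc j) /2^ (suc j) ℚ.≤ r j /2^ j ℚ.+ 2 /2^ j
  step j = subst (r (suc j) /2^ (suc j) ℚ.≤_) (sym (dyadic-+ (r j) 2 j))
    (dyadic-mono {r (suc j)} {r j ℕ.+ 2} (suc j) j (begin
      r (suc j) ℕ.* 2^ j              ≤⟨ ℕ.*-monoˡ-≤ (2^ j) (upper j) ⟩
      (2 ℕ.* suc (r j)) ℕ.* 2^ j      ≤⟨ ℕ.*-monoˡ-≤ (2^ j) (ℕ.*-monoʳ-≤ 2 (ℕ.≤-trans (ℕ.n≤1+n _) (ℕ.≤-reflexive (ℕ.+-comm 2 (r j))))) ⟩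
      (2 ℕ.* (r j ℕ.+ 2)) ℕ.* 2^ j    ≡⟨ solve 2 (λ a b → (con 2 :* a) :* b := a :* (con 2 :* b)) refl (r j ℕ.+ 2) (2^ j) ⟩
      (r j ℕ.+ 2) ℕ.* 2^ (suc j)      ∎))
    where open ℕ.≤-Reasoning
          open +-*-Solver

_^[_/_] : (n p q : ℕ) .{{_ : NonZero q}} → ℝ
n ^[ p / q ] = root q (n ℕ.^ p)

infix 4 _=Ω_
_=Ω_ : (f g : ℕ → ℝ) → Set
f =Ω g = ∃[ c ] 0ℚ ℚ.< c × ∃[ N ] ∀ l → N ℕ.≤ l → fromℚ c *ᴿ g l ≤ᴿ f l

module Submission where

-- Walking from any edge into the heavier subtree, one finds an edge of the
-- rank-decomposition for which each side has at least a third of the n = m^k vertices.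
--
-- Let X be such a side. Replacing the coordinates of a vertex of X by those of a
-- vertex of ∁ X one at a time shows that 4 |X| |∁ X| ≤ m · n · L, where L is the
-- number of lines of the torus that meet both X and ∁ X; here a line with a vertices
-- in X and b in ∁ X contributes 4 a b ≤ (a + b)² = m². On each such line take the
-- edge where membership in X first changes. For a fixed direction and orientation
-- these edges, from their X-ends as rows to their other ends as columns, index a
-- triangular submatrix of the cut matrix. So L ≤ 2 k ρ(X), which gives
-- 4 m^(k-1) ≤ 9 k ρ(X), whereas (e ln 2) / 5 ≤ 3 · 0.7 / 5 < 4 / 9.

open import Defs
open import Algebra.Bundles using (CommutativeRing)
import Algebra.Properties.CommutativeMonoid.Sum as Sum
open import Data.Bool.Base using (Bool; true; false; not; _∧_)
import Data.Bool.Properties as Bool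
open import Data.Fin.Base
  using (Fin; zero; suc; toℕ; fromℕ<; finToFun; combine; quotient; remainder; _↑ˡ_; _↑ʳ_)
import Data.Fin.Properties as Fin
open import Data.Fin.Subset using (Subset; inside; outside; Nonempty; ⁅_⁆; _∈_; _∉_; _⊆_; ∁; _∪_; _-_; ⊤)
  renaming (∣_∣ to card)
open import Data.Fin.Subset.Properties
  using (nonempty?; _⊆?_; x∈⁅x⁆; x∈⁅y⁆⇒x≡y; ∣⁅x⁆∣≡1; ∣⊤∣≡n; p⊆q⇒∣p∣≤∣q∣; p⊂q⇒∣p∣<∣q∣; x∈p∪q⁺;
         p─q⊆p; x∈p⇒∣p-x∣<∣p∣; x∈p∧x≢y⇒x∈p-y)
import Data.Integer.Properties as ℤ
open import Data.List.Base as List using (List; []; _∷_; [_]; _++_)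
open import Data.List.Extrema.Nat using (max; xs≤max)
import Data.List.Membership.DecPropositional as DecMembership
import Data.List.Membership.Propositional as List
import Data.List.Membership.Propositional.Properties as List
import Data.List.Properties as List
import Data.List.Relation.Unary.All as All
open import Data.List.Relation.Unary.All.Properties using (¬Any⇒All¬)
open import Data.List.Relation.Unary.AllPairs using ([]; _∷_)
open import Data.List.Relation.Unary.Any using (here; there)
open import Data.List.Relation.Unary.Linked using (Linked; [-]; _∷_)
open import Data.List.Relation.Unary.Unique.Propositional using (Unique)
open import Data.Nat.Base as ℕ using (ℕ; zero; suc; z≤n; s≤s; NonZero; >-nonZero; _!)
open import Data.Nat.Induction using (<-wellFounded)
import Data.Nat.Properties as ℕ
open import Data.Nat.Tactic.RingSolver using (solve-∀)
open import Algebra.Properties.Semiring.Sum ℕ.+-*-semiring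
  using (sum; ∑-distrib-+; ∑-comm; *-distribˡ-sum; *-distribʳ-sum; sum-cong-≗)
open import Data.Product.Base using (∃; ∃-syntax; _×_; _,_; proj₁; proj₂)
open import Data.Rational.Base as ℚ using (ℚ; 0ℚ; 1ℚ)
import Data.Rational.Properties as ℚ
import Data.Rational.Unnormalised.Base as ℚᵘ
import Data.Rational.Unnormalised.Properties as ℚᵘ
open import Data.Sum.Base using (_⊎_; inj₁; inj₂)
open import Data.Vec.Base using (tabulate; lookup; []; _∷_; here; there)
open import Data.Vec.Properties using (lookup⇒[]=; []=⇒lookup; lookup∘tabulate; lookup-map)
open import Function.Base using (_∘_)
open import Function.Bundles using (Bijection)
open import Induction.WellFounded using (Acc; acc)
open import Level using (0ℓ)
open import Relation.Binary.Core using (Rel)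
open import Relation.Binary.Construct.Closure.ReflexiveTransitive as Star using (Star; ε; _◅_; _◅◅_)
open import Relation.Binary.PropositionalEquality
  using (_≡_; _≢_; _≗_; refl; sym; trans; cong; cong₂; subst; module ≡-Reasoning)
open import Relation.Nullary using (Dec; yes; no; ¬_; contradiction)
open import Relation.Nullary.Decidable using (⌊_⌋; from-yes; ¬?; _×-dec_; _→-dec_)

-- Bounds on real sequences

module _ where
  open import Data.Integer.Base using (+_)
  open import Data.Rational.Base using (_/_; _+_; _*_; _≤_; _<_)

  /-* : ∀ a b c d .{{_ : NonZero b}} .{{_ : NonZero d}} .{{_ : NonZero (b ℕ.* d)}} →
        (+ a / b) * (+ c / d) ≡ + (a ℕ.* c) / (b ℕ.* d)
  /-* a b@(suc _) c d@(suc _) = ℚ.toℚᵘ-injective (begin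
    ℚ.toℚᵘ ((+ a / b) * (+ c / d))               ≈⟨ ℚ.toℚᵘ-homo-* (+ a / b) (+ c / d) ⟩
    ℚ.toℚᵘ (+ a / b) ℚᵘ.* ℚ.toℚᵘ (+ c / d)       ≈⟨ ℚᵘ.*-cong (ℚ.toℚᵘ-fromℚᵘ (+ a ℚᵘ./ b)) (ℚ.toℚᵘ-fromℚᵘ (+ c ℚᵘ./ d)) ⟩
    (+ a ℚᵘ./ b) ℚᵘ.* (+ c ℚᵘ./ d)               ≡⟨ cong (ℚᵘ._/ (b ℕ.* d)) (sym (ℤ.pos-* a c)) ⟩
    + (a ℕ.* c) ℚᵘ./ (b ℕ.* d)                   ≈⟨ ℚᵘ.≃-sym (ℚ.toℚᵘ-fromℚᵘ (+ (a ℕ.* c) ℚᵘ./ (b ℕ.* d))) ⟩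
    ℚ.toℚᵘ (+ (a ℕ.* c) / (b ℕ.* d))             ∎)
    where open import Relation.Binary.Reasoning.Setoid ℚᵘ.≃-setoid

  *-mono-≤ : ∀ {a b c d} → 0ℚ ≤ a → 0ℚ ≤ c → a ≤ b → c ≤ d → a * c ≤ b * d
  *-mono-≤ {a} {b} {c} {d} 0≤a 0≤c a≤b c≤d = ℚ.≤-trans
    (ℚ.*-monoʳ-≤-nonNeg c {{ℚ.nonNegative 0≤c}} a≤b)
    (ℚ.*-monoˡ-≤-nonNeg b {{ℚ.nonNegative (ℚ.≤-trans 0≤a a≤b)}} c≤d)

  p≤p+δ : ∀ p {δ} → 0ℚ < δ → p ≤ p + δ
  p≤p+δ p {δ} 0<δ = subst (_≤ p + δ) (ℚ.+-identityʳ p) (ℚ.+-monoʳ-≤ p (ℚ.<⇒≤ 0<δ))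

  Eventually : (ℕ → Set) → Set
  Eventually P = ∃[ N ] ∀ i → N ℕ.≤ i → P i

  eventually-× : ∀ {P Q} → Eventually P → Eventually Q → Eventually (λ i → P i × Q i)
  eventually-× (M , p) (N , q) = M ℕ.⊔ N , λ i le →
    p i (ℕ.≤-trans (ℕ.m≤m⊔n M N) le) , q i (ℕ.≤-trans (ℕ.m≤n⊔m M N) le)

  eventually-map : ∀ {P Q} → (∀ i → P i → Q i) → Eventually P → Eventually Q
  eventually-map f (N , p) = N , λ i le → f i (p i le)

  ≤ᴿ-eventually : ∀ x y → Eventually (λ i → seq x i ≤ seq y i) → x ≤ᴿ y
  ≤ᴿ-eventually x y ev δ 0<δ = eventually-map (λ i le → ℚ.≤-trans le (p≤p+δ (seq y i) 0<δ)) ev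

  fromDistance : ∀ {P : ℕ → Set} j → (∀ d → P (d ℕ.+ j)) → Eventually P
  fromDistance {P} j p = j , λ i j≤i → subst P (ℕ.m∸n+n≡m j≤i) (p (i ℕ.∸ j))

  module _ (t : ℕ → ℚ) where

    partialSum≥ : (∀ i → 0ℚ ≤ t i) → ∀ j → Eventually (λ i → partialSum t j ≤ partialSum t i)
    partialSum≥ 0≤t j = fromDistance j grow
      where
      grow : ∀ d → partialSum t j ≤ partialSum t (d ℕ.+ j)
      grow zero    = ℚ.≤-refl
      grow (suc d) = ℚ.≤-trans (grow d)
        (subst (_≤ partialSum t (suc (d ℕ.+ j))) (ℚ.+-identityʳ _) (ℚ.+-monoʳ-≤ (partialSum t (d ℕ.+ j)) (0≤t (d ℕ.+ j))))

    -- From `j` on, each new term is at most half of `c /2^ (s + i)`, so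
    -- `partialSum t i + c /2^ (s + i)` never increases. Its value at `j` bounds all later partial
    -- sums.
    partialSum≤ : ∀ c s j → (∀ i → j ℕ.≤ i → t i ≤ c /2^ suc (s ℕ.+ i)) →
                  Eventually (λ i → partialSum t i ≤ partialSum t j + c /2^ (s ℕ.+ j))
    partialSum≤ c s j t≤ = fromDistance j (λ d → ℚ.≤-trans
      (subst (_≤ partialSum t (d ℕ.+ j) + c /2^ (s ℕ.+ (d ℕ.+ j))) (ℚ.+-identityʳ _)
        (ℚ.+-monoʳ-≤ (partialSum t (d ℕ.+ j)) (/-nonNeg c (2^ (s ℕ.+ (d ℕ.+ j))) {{2^≢0 (s ℕ.+ (d ℕ.+ j))}})))
      (invariant d))
      where
      halves : ∀ n → c /2^ suc n + c /2^ suc n ≡ c /2^ n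
      halves n = trans (dyadic-+ c c (suc n)) (ℚ.≤-antisym
        (dyadic-mono {c ℕ.+ c} {c} (suc n) n (ℕ.≤-reflexive (eq c (2^ n))))
        (dyadic-mono {c} {c ℕ.+ c} n (suc n) (ℕ.≤-reflexive (sym (eq c (2^ n))))))
        where
        eq : ∀ c p → (c ℕ.+ c) ℕ.* p ≡ c ℕ.* (2 ℕ.* p)
        eq = solve-∀
      invariant : ∀ d → partialSum t (d ℕ.+ j) + c /2^ (s ℕ.+ (d ℕ.+ j)) ≤ partialSum t j + c /2^ (s ℕ.+ j)
      invariant zero    = ℚ.≤-refl
      invariant (suc d) = begin
        (S + t i) + c /2^ (s ℕ.+ suc i)                  ≡⟨ cong (λ n → (S + t i) + c /2^ n) (ℕ.+-suc s i) ⟩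
        (S + t i) + c /2^ suc (s ℕ.+ i)                  ≤⟨ ℚ.+-monoˡ-≤ (c /2^ suc (s ℕ.+ i)) (ℚ.+-monoʳ-≤ S (t≤ i (ℕ.m≤n+m j d))) ⟩
        (S + c /2^ suc (s ℕ.+ i)) + c /2^ suc (s ℕ.+ i)  ≡⟨ ℚ.+-assoc S _ _ ⟩
        S + (c /2^ suc (s ℕ.+ i) + c /2^ suc (s ℕ.+ i))  ≡⟨ cong (S ℚ.+_) (halves (s ℕ.+ i)) ⟩
        S + c /2^ (s ℕ.+ i)                              ≤⟨ invariant d ⟩
        partialSum t j + c /2^ (s ℕ.+ j)                 ∎
        where
        open ℚ.≤-Reasoning
        i = d ℕ.+ j
        S = partialSum t i

  e-term : ℕ → ℚ
  e-term i = (+ 1 / (i !)) {{i ℕ.!≢0}}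

  ln2-term : ℕ → ℚ
  ln2-term i = (+ 1 / (suc i ℕ.* 2^ (suc i))) {{ℕ.m*n≢0 (suc i) (2^ (suc i)) {{_}} {{2^≢0 (suc i)}}}}

  2^i≤[1+i]! : ∀ i → 2^ i ℕ.≤ suc i !
  2^i≤[1+i]! zero    = ℕ.≤-refl
  2^i≤[1+i]! (suc i) = ℕ.*-mono-≤ (s≤s (s≤s (z≤n {i}))) (2^i≤[1+i]! i)

  e-term≤ : ∀ i → 1 ℕ.≤ i → e-term i ≤ 4 /2^ suc i
  e-term≤ (suc i) _ = /-mono {1} {4} (suc i !) (2^ (suc (suc i))) {{suc i ℕ.!≢0}} {{2^≢0 (suc (suc i))}} (begin
    1 ℕ.* 2^ (suc (suc i))    ≡⟨ eq (2^ i) ⟩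
    4 ℕ.* 2^ i              ≤⟨ ℕ.*-monoʳ-≤ 4 (2^i≤[1+i]! i) ⟩
    4 ℕ.* suc i !           ∎)
    where
    open ℕ.≤-Reasoning
    eq : ∀ p → 1 ℕ.* (2 ℕ.* (2 ℕ.* p)) ≡ 4 ℕ.* p
    eq = solve-∀

  ln2-term≤ : ∀ i → 3 ℕ.≤ i → ln2-term i ≤ 1 /2^ suc (2 ℕ.+ i)
  ln2-term≤ i 3≤i = /-mono {1} {1} (suc i ℕ.* 2^ (suc i)) (2^ (suc (2 ℕ.+ i)))
    {{ℕ.m*n≢0 (suc i) (2^ (suc i)) {{_}} {{2^≢0 (suc i)}}}} {{2^≢0 (suc (2 ℕ.+ i))}} (begin
    1 ℕ.* (2 ℕ.* (2 ℕ.* (2 ℕ.* 2^ i)))   ≡⟨ eq (2^ i) ⟩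
    1 ℕ.* (4 ℕ.* (2 ℕ.* 2^ i))           ≤⟨ ℕ.*-monoʳ-≤ 1 (ℕ.*-monoˡ-≤ (2 ℕ.* 2^ i) (s≤s 3≤i)) ⟩
    1 ℕ.* (suc i ℕ.* (2 ℕ.* 2^ i))       ∎)
    where
    open ℕ.≤-Reasoning
    eq : ∀ p → 1 ℕ.* (2 ℕ.* (2 ℕ.* (2 ℕ.* p))) ≡ 1 ℕ.* (4 ℕ.* (2 ℕ.* p))
    eq = solve-∀

  e-bounds : Eventually (λ i → 1ℚ ≤ seq e i × seq e i ≤ + 3 / 1)
  e-bounds = eventually-×
    (partialSum≥ e-term (λ i → /-nonNeg 1 (i !) {{i ℕ.!≢0}}) 1)
    -- The term for 0! is 1, and from `i` = 1 on the terms are at most 2/2^i, in total at most 2.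
    (eventually-map (λ i le → ℚ.≤-trans le (from-yes (partialSum e-term 1 + 4 /2^ 1 ℚ.≤? + 3 / 1)))
      (partialSum≤ e-term 4 0 1 e-term≤))

  ln2-bounds : Eventually (λ i → + 1 / 2 ≤ seq ln2 i × seq ln2 i ≤ + 7 / 10)
  ln2-bounds = eventually-×
    (partialSum≥ ln2-term (λ i → /-nonNeg 1 (suc i ℕ.* 2^ (suc i)) {{ℕ.m*n≢0 (suc i) (2^ (suc i)) {{_}} {{2^≢0 (suc i)}}}}) 1)
    -- Three terms give 2/3 and the tail at most 1/32, in all 67/96. Some precision is called for:
    -- the bound 3/4 would only give 3 · (3/4) / 5 = 9/20, which exceeds 4/9.
    (eventually-map (λ i le → ℚ.≤-trans le (from-yes (partialSum ln2-term 3 + 1 /2^ 5 ℚ.≤? + 7 / 10)))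
      (partialSum≤ ln2-term 1 2 3 ln2-term≤))

  -- The upper estimate, 3 · 0.7 / 5 = 21/50, is compared with the combinatorial constant 4/9; the
  -- lower one, 1 · 0.5 / 5, supplies the constant of the Ω-statement.
  constant-bounds : Eventually (λ i → + 1 / 10 ≤ seq e i * seq ln2 i * (+ 1 / 5) × seq e i * seq ln2 i * (+ 1 / 5) ≤ + 4 / 9)
  constant-bounds = eventually-map
    (λ { i ((1≤e , e≤3) , (½≤ln2 , ln2≤7/10)) →
      let 0≤e   = ℚ.≤-trans (from-yes (0ℚ ℚ.≤? 1ℚ)) 1≤e
          0≤ln2 = ℚ.≤-trans (from-yes (0ℚ ℚ.≤? + 1 / 2)) ½≤ln2
          0≤⅕   = from-yes (0ℚ ℚ.≤? + 1 / 5)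
      in ℚ.≤-trans (from-yes (+ 1 / 10 ℚ.≤? 1ℚ * (+ 1 / 2) * (+ 1 / 5)))
           (*-mono-≤ (from-yes (0ℚ ℚ.≤? 1ℚ * (+ 1 / 2))) 0≤⅕
             (*-mono-≤ (from-yes (0ℚ ℚ.≤? 1ℚ)) (from-yes (0ℚ ℚ.≤? + 1 / 2)) 1≤e ½≤ln2) ℚ.≤-refl)
       , ℚ.≤-trans (*-mono-≤ (subst (_≤ seq e i * seq ln2 i) (ℚ.*-zeroˡ 0ℚ) (*-mono-≤ ℚ.≤-refl ℚ.≤-refl 0≤e 0≤ln2)) 0≤⅕
             (*-mono-≤ 0≤e 0≤ln2 e≤3 ln2≤7/10) ℚ.≤-refl)
           (from-yes ((+ 3 / 1) * (+ 7 / 10) * (+ 1 / 5) ℚ.≤? + 4 / 9)) })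
    (eventually-× e-bounds ln2-bounds)

  ^-cancelʳ-≤ : ∀ q {a b} → a ℕ.^ suc q ℕ.≤ b ℕ.^ suc q → a ℕ.≤ b
  ^-cancelʳ-≤ q le = ℕ.≮⇒≥ λ b<a → ℕ.<⇒≱ (ℕ.^-monoˡ-< (suc q) b<a) le

  -- The radicand is exactly the `suc q`-th power of `M * 2^ j`, so its rounded-down root cannot
  -- exceed `M * 2^ j`.
  root-upper : ∀ q M j → seq (root (suc q) (M ℕ.^ suc q)) j ≤ + M / 1
  root-upper q M j = /-mono {r} {M} (2^ j) 1 {{2^≢0 j}} (begin
    r ℕ.* 1     ≡⟨ ℕ.*-identityʳ r ⟩
    r           ≤⟨ ^-cancelʳ-≤ q (ℕ.≤-trans (rootBelow-sound (suc q) N N)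
                     (ℕ.≤-reflexive (sym (^-distrib-* (suc q) M (2^ j))))) ⟩
    M ℕ.* 2^ j  ∎)
    where
    open ℕ.≤-Reasoning
    N = M ℕ.^ suc q ℕ.* 2^ j ℕ.^ suc q
    r = ⌊root⌋ (suc q) N

open import Data.Nat.Base using (_+_; _*_; _∸_; _^_; _≤_; _<_)

-- An isoperimetric inequality in the grid

⟦_⟧ : Bool → ℕ
⟦ true  ⟧ = 1
⟦ false ⟧ = 0

# : ∀ {n} → (Fin n → Bool) → ℕ
# f = sum (λ i → ⟦ f i ⟧)

card≡# : ∀ {n} (p : Subset n) → card p ≡ # (lookup p)
card≡# []            = refl
card≡# (outside ∷ p) = card≡# p
card≡# (inside ∷ p)  = cong suc (card≡# p)

sum-mono : ∀ {n} {f g : Fin n → ℕ} → (∀ i → f i ≤ g i) → sum f ≤ sum g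
sum-mono {zero}  le = z≤n
sum-mono {suc n} le = ℕ.+-mono-≤ (le zero) (sum-mono (le ∘ suc))

sum-const : ∀ n c → sum {n} (λ _ → c) ≡ n * c
sum-const zero    c = refl
sum-const (suc n) c = cong (c +_) (sum-const n c)

term≤sum : ∀ {n} (f : Fin n → ℕ) i → f i ≤ sum f
term≤sum f zero    = ℕ.m≤m+n _ _
term≤sum f (suc i) = ℕ.≤-trans (term≤sum (f ∘ suc) i) (ℕ.m≤n+m _ (f zero))

#≤n : ∀ {n} (f : Fin n → Bool) → # f ≤ n
#≤n {n} f = ℕ.≤-trans (sum-mono (λ i → ⟦⟧≤1 (f i)))
                      (ℕ.≤-reflexive (trans (sum-const n 1) (ℕ.*-identityʳ n)))
  where
  ⟦⟧≤1 : ∀ b → ⟦ b ⟧ ≤ 1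
  ⟦⟧≤1 true  = ℕ.≤-refl
  ⟦⟧≤1 false = z≤n

#+#not : ∀ {n} (f : Fin n → Bool) → # f + # (not ∘ f) ≡ n
#+#not {zero}  f = refl
#+#not {suc n} f with f zero
... | true  = cong suc (#+#not (f ∘ suc))
... | false = trans (ℕ.+-suc _ _) (cong suc (#+#not (f ∘ suc)))

sum-↑ : ∀ p {q} (f : Fin (p + q) → ℕ) → sum f ≡ sum (f ∘ (_↑ˡ q)) + sum (f ∘ (p ↑ʳ_))
sum-↑ zero    f = refl
sum-↑ (suc p) f = trans (cong (f zero +_) (sum-↑ p (f ∘ suc))) (sym (ℕ.+-assoc (f zero) _ _))

sum-combine : ∀ m {p} (f : Fin (m * p) → ℕ) → sum f ≡ sum (λ a → sum (λ x → f (combine {m} a x)))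
sum-combine zero    f = refl
sum-combine (suc m) {p} f =
  trans (sum-↑ p f) (cong (sum (λ x → f (x ↑ˡ (m * p))) +_) (sum-combine m (f ∘ (p ↑ʳ_))))

product-sums : ∀ {m n} (f : Fin m → ℕ) (g : Fin n → ℕ) → sum f * sum g ≡ sum (λ a → sum (λ b → f a * g b))
product-sums f g = trans (*-distribʳ-sum (sum g) f) (sum-cong-≗ (λ a → *-distribˡ-sum (f a) g))

module Grid (m : ℕ) where

  cons : ∀ k → Fin m → Fin (m ^ k) → Fin (m ^ suc k)
  cons k a x = combine a x

  first : ∀ k → Fin (m ^ suc k) → Fin m
  first k x = quotient {m} (m ^ k) x

  rest : ∀ k → Fin (m ^ suc k) → Fin (m ^ k)
  rest k x = remainder {m} (m ^ k) x

  cons-first-rest : ∀ k x → cons k (first k x) (rest k x) ≡ x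
  cons-first-rest k x = Fin.combine-remQuot {m} (m ^ k) x

  first-cons : ∀ k a x → first k (cons k a x) ≡ a
  first-cons k a x = cong proj₁ (Fin.remQuot-combine {m} {m ^ k} a x)

  rest-cons : ∀ k a x → rest k (cons k a x) ≡ x
  rest-cons k a x = cong proj₂ (Fin.remQuot-combine {m} {m ^ k} a x)

  -- `cons` makes the new coordinate the most significant digit, as `finToFun` does. Hence
  -- `coord (suc k) x zero` is `first k x` by definition, and the later coordinates of `x` are those
  -- of `rest k x`.
  coord : ∀ k → Fin (m ^ k) → Fin k → Fin m
  coord k = finToFun {m} {k}

  coord-injective : ∀ k {x y} → coord k x ≗ coord k y → x ≡ y
  coord-injective zero    {zero} {zero} _ = refl
  coord-injective (suc k) {x} {y} eq = begin
    x                               ≡⟨ sym (cons-first-rest k x) ⟩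
    cons k (first k x) (rest k x)   ≡⟨ cong₂ (cons k) (eq zero) (coord-injective k (eq ∘ suc)) ⟩
    cons k (first k y) (rest k y)   ≡⟨ cons-first-rest k y ⟩
    y                               ∎
    where open ≡-Reasoning

  set : ∀ k → Fin k → Fin m → Fin (m ^ k) → Fin (m ^ k)
  set (suc k) zero    a x = cons k a (rest k x)
  set (suc k) (suc i) a x = cons k (first k x) (set k i a (rest k x))

  set-same : ∀ k i a x → coord k (set k i a x) i ≡ a
  set-same (suc k) zero    a x = first-cons k a (rest k x)
  set-same (suc k) (suc i) a x = trans (cong (λ y → coord k y i) (rest-cons k (first k x) _))
                                       (set-same k i a (rest k x))

  set-other : ∀ k i a x j → j ≢ i → coord k (set k i a x) j ≡ coord k x j
  set-other (suc k) zero    a x zero    j≢i = contradiction refl j≢i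
  set-other (suc k) zero    a x (suc j) _   = cong (λ y → coord k y j) (rest-cons k a (rest k x))
  set-other (suc k) (suc i) a x zero    _   = first-cons k (first k x) (set k i a (rest k x))
  set-other (suc k) (suc i) a x (suc j) j≢i =
    trans (cong (λ y → coord k y j) (rest-cons k (first k x) _))
          (set-other k i a (rest k x) j (j≢i ∘ cong suc))

  line : ∀ k → (Fin (m ^ k) → Bool) → Fin k → Fin (m ^ k) → Fin m → Bool
  line k f i x a = f (set k i a x)

  -- `P g` weighs the positions on a line to which the set restricts as `g`, and `P-line` is the
  -- one-dimensional inequality that the induction lifts to all dimensions. `P-cong` enters because
  -- restrictions computed in different ways agree only pointwise.
  module Isoperimetry (P : (Fin m → Bool) → Fin m → ℕ)
    (P-cong : ∀ {g h} → g ≗ h → P g ≗ P h)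
    (P-line : ∀ g → 4 * (# g * # (not ∘ g)) ≤ m * m * sum (P g)) where

    -- A vertex `x` fixes a line in direction `i` and a position on it, so this is the sum of
    -- `sum (P g)` over all lines in direction `i`, each line taken once.
    weight : ∀ k → (Fin (m ^ k) → Bool) → Fin k → ℕ
    weight k f i = sum (λ x → P (line k f i x) (coord k x i))

    slice : ∀ k → (Fin (m ^ suc k) → Bool) → Fin m → Fin (m ^ k) → Bool
    slice k f a x = f (cons k a x)

    sum-cons : ∀ k (t : Fin (m ^ suc k) → ℕ) → sum t ≡ sum (λ a → sum (λ x → t (cons k a x)))
    sum-cons k = sum-combine m

    weight-zero : ∀ k (f : Fin (m ^ suc k) → Bool) →
                  weight (suc k) f zero ≡ sum (λ x → sum (P (λ a → slice k f a x)))
    weight-zero k f = begin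
      weight (suc k) f zero
        ≡⟨ sum-cons k (λ x → P (line (suc k) f zero x) (coord (suc k) x zero)) ⟩
      sum (λ a → sum (λ x → P (line (suc k) f zero (cons k a x)) (coord (suc k) (cons k a x) zero)))
        ≡⟨ sum-cong-≗ (λ a → sum-cong-≗ (eq a)) ⟩
      sum (λ a → sum (λ x → P (λ b → slice k f b x) a))
        ≡⟨ ∑-comm (λ a x → P (λ b → slice k f b x) a) ⟩
      sum (λ x → sum (P (λ a → slice k f a x))) ∎
      where
      open ≡-Reasoning
      eq : ∀ a x → P (line (suc k) f zero (cons k a x)) (coord (suc k) (cons k a x) zero)
                 ≡ P (λ b → slice k f b x) a
      eq a x = trans (cong (P _) (first-cons k a x))
                     (P-cong (λ b → cong (λ y → f (cons k b y)) (rest-cons k a x)) a)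

    weight-suc : ∀ k (f : Fin (m ^ suc k) → Bool) i →
                 weight (suc k) f (suc i) ≡ sum (λ a → weight k (slice k f a) i)
    weight-suc k f i = trans
      (sum-cons k (λ x → P (line (suc k) f (suc i) x) (coord (suc k) x (suc i))))
      (sum-cong-≗ (λ a → sum-cong-≗ (eq a)))
      where
      eq : ∀ a x → P (line (suc k) f (suc i) (cons k a x)) (coord (suc k) (cons k a x) (suc i))
                 ≡ P (line k (slice k f a) i x) (coord k x i)
      eq a x = trans (cong (λ y → P (line (suc k) f (suc i) (cons k a x)) (coord k y i)) (rest-cons k a x))
        (P-cong (λ b → cong₂ (λ c y → f (cons k c (set k i b y))) (first-cons k a x) (rest-cons k a x)) _)

    -- Count the pairs `(x , y)` with `f x` true and `g y` false according to `g x`. If it is false,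
    -- the sum counts `x`, and `y` has at most `p` choices; if it is true, the pair is one of those
    -- separated by `g` itself.
    exchange : ∀ {p} (f g : Fin p → Bool) →
               # f * # (not ∘ g) ≤ p * sum (λ x → ⟦ f x ⟧ * ⟦ not (g x) ⟧) + # g * # (not ∘ g)
    exchange {p} f g = begin
      # f * # (not ∘ g)                    ≤⟨ ℕ.*-monoˡ-≤ (# (not ∘ g)) #f≤ ⟩
      (C + # g) * # (not ∘ g)              ≡⟨ ℕ.*-distribʳ-+ (# (not ∘ g)) C (# g) ⟩
      C * # (not ∘ g) + # g * # (not ∘ g)  ≤⟨ ℕ.+-monoˡ-≤ _ (ℕ.*-monoʳ-≤ C (#≤n (not ∘ g))) ⟩
      C * p + # g * # (not ∘ g)            ≡⟨ cong (_+ # g * # (not ∘ g)) (ℕ.*-comm C p) ⟩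
      p * C + # g * # (not ∘ g)            ∎
      where
      open ℕ.≤-Reasoning
      C = sum (λ x → ⟦ f x ⟧ * ⟦ not (g x) ⟧)
      pointwise : ∀ a b → ⟦ a ⟧ ≤ ⟦ a ⟧ * ⟦ not b ⟧ + ⟦ b ⟧
      pointwise true  true  = ℕ.≤-refl
      pointwise true  false = ℕ.≤-refl
      pointwise false b     = z≤n
      #f≤ : # f ≤ C + # g
      #f≤ = ℕ.≤-trans (sum-mono (λ x → pointwise (f x) (g x)))
                      (ℕ.≤-reflexive (∑-distrib-+ (λ x → ⟦ f x ⟧ * ⟦ not (g x) ⟧) (λ x → ⟦ g x ⟧)))

    -- Between (a, x) in the set and (b, y) outside it stands (b, x). If that point is outside, the
    -- line through `x` in the first direction is split, with `m ^ k` choices for y; if it is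
    -- inside, slice `b` is split, with `m` choices for a.
    split-first : ∀ k (f : Fin (m ^ suc k) → Bool) →
      # f * # (not ∘ f) ≤ m ^ k * sum (λ x → # (λ a → slice k f a x) * # (λ a → not (slice k f a x)))
                        + m * sum (λ b → # (slice k f b) * # (not ∘ slice k f b))
    split-first k f = begin
      # f * # (not ∘ f)
        ≡⟨ cong₂ _*_ (sum-cons k (λ x → ⟦ f x ⟧)) (sum-cons k (λ x → ⟦ not (f x) ⟧)) ⟩
      sum (λ a → # (F a)) * sum (λ b → # (not ∘ F b))
        ≡⟨ product-sums (λ a → # (F a)) (λ b → # (not ∘ F b)) ⟩
      sum (λ a → sum (λ b → # (F a) * # (not ∘ F b)))
        ≤⟨ sum-mono (λ a → sum-mono (λ b → exchange (F a) (F b))) ⟩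
      sum (λ a → sum (λ b → p * C a b + D b))
        ≡⟨ sum-cong-≗ (λ a → ∑-distrib-+ (λ b → p * C a b) D) ⟩
      sum (λ a → sum (λ b → p * C a b) + sum D)
        ≡⟨ ∑-distrib-+ (λ a → sum (λ b → p * C a b)) (λ _ → sum D) ⟩
      sum (λ a → sum (λ b → p * C a b)) + sum {m} (λ _ → sum D)
        ≡⟨ cong₂ _+_ (sym (trans (*-distribˡ-sum p (λ a → sum (C a))) (sum-cong-≗ (λ a → *-distribˡ-sum p (C a)))))
                     (sum-const m (sum D)) ⟩
      p * sum (λ a → sum (C a)) + m * sum D
        ≡⟨ cong (λ z → p * z + m * sum D) reorder ⟩
      p * sum (λ x → # (λ a → F a x) * # (λ a → not (F a x))) + m * sum D ∎
      where
      open ℕ.≤-Reasoning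
      p = m ^ k
      F = slice k f
      C : Fin m → Fin m → ℕ
      C a b = sum (λ x → ⟦ F a x ⟧ * ⟦ not (F b x) ⟧)
      D : Fin m → ℕ
      D b = # (F b) * # (not ∘ F b)
      reorder : sum (λ a → sum (C a)) ≡ sum (λ x → # (λ a → F a x) * # (λ a → not (F a x)))
      reorder = trans (sum-cong-≗ (λ a → ∑-comm (λ b x → ⟦ F a x ⟧ * ⟦ not (F b x) ⟧)))
        (trans (∑-comm (λ a x → sum (λ b → ⟦ F a x ⟧ * ⟦ not (F b x) ⟧)))
          (sum-cong-≗ (λ x → sym (product-sums (λ a → ⟦ F a x ⟧) (λ b → ⟦ not (F b x) ⟧)))))

    -- Induction on the dimension; for a single point one of the two factors is zero. In the step,
    -- `P-line` treats the first direction and the induction hypothesis the slices, and both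
    -- summands of `split-first` end up with the same factor m · m^(k+1).
    isoperimetric : ∀ k (f : Fin (m ^ k) → Bool) →
                    4 * (# f * # (not ∘ f)) ≤ m * m ^ k * sum (weight k f)
    isoperimetric zero f with f zero
    ... | true  = z≤n
    ... | false = z≤n
    isoperimetric (suc k) f = begin
      4 * (# f * # (not ∘ f))
        ≤⟨ ℕ.*-monoʳ-≤ 4 (split-first k f) ⟩
      4 * (p * sum lines + m * sum slices)
        ≡⟨ distribute p (sum lines) m (sum slices) ⟩
      p * (4 * sum lines) + m * (4 * sum slices)
        ≤⟨ ℕ.+-mono-≤ (ℕ.*-monoʳ-≤ p firstDirection) (ℕ.*-monoʳ-≤ m otherDirections) ⟩
      p * (m * m * W zero) + m * (m * p * sum (W ∘ suc))
        ≡⟨ collect p m (W zero) _ ⟩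
      m * (m * p) * (W zero + sum (W ∘ suc)) ∎
      where
      open ℕ.≤-Reasoning
      p = m ^ k
      F = slice k f
      W = weight (suc k) f
      lines : Fin p → ℕ
      lines x = # (λ a → F a x) * # (λ a → not (F a x))
      slices : Fin m → ℕ
      slices b = # (F b) * # (not ∘ F b)
      distribute : ∀ p x m y → 4 * (p * x + m * y) ≡ p * (4 * x) + m * (4 * y)
      distribute = solve-∀
      collect : ∀ p m x y → p * (m * m * x) + m * (m * p * y) ≡ m * (m * p) * (x + y)
      collect = solve-∀
      firstDirection : 4 * sum lines ≤ m * m * W zero
      firstDirection = begin
        4 * sum lines                                  ≡⟨ *-distribˡ-sum 4 lines ⟩
        sum (λ x → 4 * lines x)                        ≤⟨ sum-mono (λ x → P-line (λ a → F a x)) ⟩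
        sum (λ x → m * m * sum (P (λ a → F a x)))      ≡⟨ sym (*-distribˡ-sum (m * m) (λ x → sum (P (λ a → F a x)))) ⟩
        m * m * sum (λ x → sum (P (λ a → F a x)))      ≡⟨ cong (m * m *_) (sym (weight-zero k f)) ⟩
        m * m * W zero                                 ∎
      otherDirections : 4 * sum slices ≤ m * p * sum (W ∘ suc)
      otherDirections = begin
        4 * sum slices                                  ≡⟨ *-distribˡ-sum 4 slices ⟩
        sum (λ b → 4 * slices b)                        ≤⟨ sum-mono (λ b → isoperimetric k (F b)) ⟩
        sum (λ b → m * p * sum (weight k (F b)))        ≡⟨ sym (*-distribˡ-sum (m * p) (λ b → sum (weight k (F b)))) ⟩
        m * p * sum (λ b → sum (weight k (F b)))        ≡⟨ cong (m * p *_) (∑-comm (λ b i → weight k (F b) i)) ⟩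
        m * p * sum (λ i → sum (λ b → weight k (F b) i)) ≡⟨ cong (m * p *_) (sum-cong-≗ (λ i → sym (weight-suc k f i))) ⟩
        m * p * sum (W ∘ suc)                           ∎

-- The first change of membership along a line

FirstStep : ∀ {m} → (Fin m → Bool) → Fin m → Fin m → Set
FirstStep g a b = suc (toℕ a) ≡ toℕ b × (∀ t → toℕ t ≤ toℕ a → g t ≡ true) × g b ≡ false

firstStep? : ∀ {m} (g : Fin m → Bool) a b → Dec (FirstStep g a b)
firstStep? g a b = (suc (toℕ a) ℕ.≟ toℕ b)
        ×-dec Fin.all? (λ t → (toℕ t ℕ.≤? toℕ a) →-dec (g t Bool.≟ true))
        ×-dec (g b Bool.≟ false)

FirstStep-cong : ∀ {m} {g h : Fin m → Bool} → g ≗ h → ∀ {a b} → FirstStep g a b → FirstStep h a b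
FirstStep-cong g≗h {b = b} (next , before , after) =
  next , (λ t t≤a → trans (sym (g≗h t)) (before t t≤a)) , trans (sym (g≗h b)) after

-- Were `a′` earlier than `a`, then `b′` would come no later than `a`, where `g` is still true,
-- although `g b′` is false.
FirstStep-unique : ∀ {m} {g : Fin m → Bool} {a b a′ b′} → FirstStep g a b → FirstStep g a′ b′ → toℕ a ≡ toℕ a′
FirstStep-unique {g = g} {a} {b} {a′} {b′} (next , before , after) (next′ , before′ , after′) =
  ℕ.≤-antisym (ℕ.≮⇒≥ (noEarlier before next′ after′)) (ℕ.≮⇒≥ (noEarlier before′ next after))
  where
  noEarlier : ∀ {a a′ b′} → (∀ t → toℕ t ≤ toℕ a → g t ≡ true) → suc (toℕ a′) ≡ toℕ b′ → g b′ ≡ false →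
              ¬ toℕ a′ < toℕ a
  noEarlier {a} {b′ = b′} before next after lt =
    contradiction (trans (sym (before b′ (subst (_≤ toℕ a) next lt))) after) λ ()

FirstStep-exists : ∀ {m} (g : Fin (suc m) → Bool) → g zero ≡ true → ∀ c → g c ≡ false → ∃[ a ] ∃[ b ] FirstStep g a b
FirstStep-exists g g0 zero gc = contradiction (trans (sym g0) gc) λ ()
FirstStep-exists {suc m} g g0 (suc c) gc with g (suc zero) in g1
... | false = zero , suc zero , refl , (λ { zero _ → g0 }) , g1
... | true with FirstStep-exists (g ∘ suc) g1 c gc
...   | a , b , next , before , after = suc a , suc b , cong suc next
        , (λ { zero _ → g0 ; (suc t) (s≤s t≤a) → before t t≤a }) , after

-- At a the line leaves g upwards (s = true) or downwards (s = false), along the edge at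
-- which g first changes its value. As there is only one such edge on each line, the
-- wrap-around edges of the cycle do no harm to triangularity.
Crossing : ∀ {m} → Bool → (Fin m → Bool) → Fin m → Set
Crossing true  g a = ∃[ b ] FirstStep g a b
Crossing false g a = ∃[ b ] FirstStep (not ∘ g) b a

crossing? : ∀ {m} s (g : Fin m → Bool) a → Dec (Crossing s g a)
crossing? true  g a = Fin.any? (λ b → firstStep? g a b)
crossing? false g a = Fin.any? (λ b → firstStep? (not ∘ g) b a)

Crossing-cong : ∀ {m} s {g h : Fin m → Bool} → g ≗ h → ∀ {a} → Crossing s g a → Crossing s h a
Crossing-cong true  g≗h (b , st) = b , FirstStep-cong g≗h st
Crossing-cong false g≗h (b , st) = b , FirstStep-cong (cong not ∘ g≗h) st

Crossing-unique : ∀ {m} s {g : Fin m → Bool} {a a′} → Crossing s g a → Crossing s g a′ → a ≡ a′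
Crossing-unique true  (b , p) (b′ , p′) = Fin.toℕ-injective (FirstStep-unique p p′)
Crossing-unique false {a = a} {a′} (b , p) (b′ , p′) =
  Fin.toℕ-injective (trans (sym (proj₁ p)) (trans (cong suc (FirstStep-unique p p′)) (proj₁ p′)))

indicator : ∀ {m} → Bool → (Fin m → Bool) → Fin m → ℕ
indicator s g a = ⟦ ⌊ crossing? s g a ⌋ ⟧

⟦⌊⌋⟧-cong : ∀ {A B : Set} (a? : Dec A) (b? : Dec B) → (A → B) → (B → A) → ⟦ ⌊ a? ⌋ ⟧ ≡ ⟦ ⌊ b? ⌋ ⟧
⟦⌊⌋⟧-cong (yes _) (yes _) _ _ = refl
⟦⌊⌋⟧-cong (yes a) (no ¬b) f _ = contradiction (f a) ¬b
⟦⌊⌋⟧-cong (no ¬a) (yes b) _ g = contradiction (g b) ¬a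
⟦⌊⌋⟧-cong (no _)  (no _)  _ _ = refl

⟦⌊⌋⟧-true : ∀ {A : Set} (a? : Dec A) → A → 1 ≤ ⟦ ⌊ a? ⌋ ⟧
⟦⌊⌋⟧-true (yes _) _ = ℕ.≤-refl
⟦⌊⌋⟧-true (no ¬a) a = contradiction a ¬a

-- On a nonconstant line exactly one orientation occurs, fixed by the value at position 0, and it
-- occurs once; on a constant line there is none. So with this `P`, the sum of `weight` over all
-- directions counts the lines meeting both the set and its complement.
crossings : ∀ {m} → (Fin m → Bool) → Fin m → ℕ
crossings g a = indicator true g a + indicator false g a

crossings-cong : ∀ {m} {g h : Fin m → Bool} → g ≗ h → crossings g ≗ crossings h
crossings-cong {g = g} {h} g≗h a = cong₂ _+_ (eq true) (eq false)
  where
  eq : ∀ s → indicator s g a ≡ indicator s h a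
  eq s = ⟦⌊⌋⟧-cong (crossing? s g a) (crossing? s h a) (Crossing-cong s g≗h) (Crossing-cong s (sym ∘ g≗h))

crossings-nonconstant : ∀ {m} (g : Fin m → Bool) c d → g c ≡ true → g d ≡ false → 1 ≤ sum (crossings g)
crossings-nonconstant {suc m} g c d gc gd = go (g zero) refl
  where
  counted : ∀ a → 1 ≤ crossings g a → 1 ≤ sum (crossings g)
  counted a le = ℕ.≤-trans le (term≤sum (crossings g) a)
  go : ∀ z → g zero ≡ z → 1 ≤ sum (crossings g)
  go true  g0 with FirstStep-exists g g0 d gd
  ... | a , b , st = counted a (ℕ.≤-trans (⟦⌊⌋⟧-true (crossing? true g a) (b , st)) (ℕ.m≤m+n _ _))
  go false g0 with FirstStep-exists (not ∘ g) (cong not g0) c (cong not gc)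
  ... | b , a , st = counted a (ℕ.≤-trans (⟦⌊⌋⟧-true (crossing? false g a) (b , st)) (ℕ.m≤n+m _ (indicator true g a)))

#≡0 : ∀ {n} (f : Fin n → Bool) → ¬ (∃[ c ] f c ≡ true) → # f ≡ 0
#≡0 {zero}  f none = refl
#≡0 {suc n} f none with f zero in f0
... | true  = contradiction (zero , f0) none
... | false = #≡0 (f ∘ suc) (λ (c , fc) → none (suc c , fc))

4ab≤[a+b]² : ∀ a b → 4 * (a * b) ≤ (a + b) * (a + b)
4ab≤[a+b]² a b with ℕ.≤-total a b
... | inj₁ a≤b = subst (λ b → 4 * (a * b) ≤ (a + b) * (a + b)) (ℕ.m+[n∸m]≡n a≤b)
                   (ℕ.≤-trans (ℕ.m≤m+n _ _) (ℕ.≤-reflexive (identity a (b ℕ.∸ a))))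
  where
  identity : ∀ a d → 4 * (a * (a + d)) + d * d ≡ (a + (a + d)) * (a + (a + d))
  identity = solve-∀
... | inj₂ b≤a = subst (λ a → 4 * (a * b) ≤ (a + b) * (a + b)) (ℕ.m+[n∸m]≡n b≤a)
                   (ℕ.≤-trans (ℕ.m≤m+n _ _) (ℕ.≤-reflexive (identity b (a ℕ.∸ b))))
  where
  identity : ∀ b d → 4 * ((b + d) * b) + d * d ≡ (b + d + b) * (b + d + b)
  identity = solve-∀

crossings-line : ∀ {m} (g : Fin m → Bool) → 4 * (# g * # (not ∘ g)) ≤ m * m * sum (crossings g)
crossings-line {m} g with Fin.any? (λ c → g c Bool.≟ true) | Fin.any? (λ c → g c Bool.≟ false)
... | no none | _ rewrite #≡0 g none = z≤n
... | yes _ | no none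
  rewrite #≡0 (not ∘ g) (λ (c , eq) → none (c , trans (sym (Bool.not-involutive (g c))) (cong not eq)))
        | ℕ.*-zeroʳ (# g) = z≤n
... | yes (c , gc) | yes (d , gd) = begin
  4 * (# g * # (not ∘ g))                     ≤⟨ 4ab≤[a+b]² (# g) (# (not ∘ g)) ⟩
  (# g + # (not ∘ g)) * (# g + # (not ∘ g))   ≡⟨ cong₂ _*_ (#+#not g) (#+#not g) ⟩
  m * m                                       ≡⟨ sym (ℕ.*-identityʳ (m * m)) ⟩
  m * m * 1                                   ≤⟨ ℕ.*-monoʳ-≤ (m * m) (crossings-nonconstant g c d gc gd) ⟩
  m * m * sum (crossings g)                   ∎
  where open ℕ.≤-Reasoning

-- Lower bounds on the cut-rank

open Sum (CommutativeRing.+-commutativeMonoid 𝔽₂) using () renaming (sum to xorSum)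

∈-max : ∀ {xs x} → x List.∈ xs → x ≤ max 0 xs
∈-max {xs} x∈ = All.lookup (xs≤max 0 xs) x∈

∈-allSubsets : ∀ {n} (p : Subset n) → p List.∈ allSubsets n
∈-allSubsets []            = here refl
∈-allSubsets (outside ∷ p) = List.∈-++⁺ˡ (List.∈-map⁺ (outside ∷_) (∈-allSubsets p))
∈-allSubsets (inside ∷ p)  = List.∈-++⁺ʳ _ (List.∈-map⁺ (inside ∷_) (∈-allSubsets p))

independent⇒card≤rank : ∀ {p q} (M : Matrix p q) {R C S} → S ⊆ R → Independent M C S → card S ≤ rank M R C
independent⇒card≤rank M {R} {C} {S} S⊆R ind =
  ∈-max (List.∈-map⁺ card (List.∈-filter⁺ (λ S → S ⊆? R ×-dec ¬? (dependent? M C S))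
    (∈-allSubsets S) ((λ {x} → S⊆R {x}) , ind)))

xorSum-false : ∀ {n} (t : Fin n → Bool) → (∀ i → t i ≡ false) → xorSum t ≡ false
xorSum-false {zero}  t t≡false = refl
xorSum-false {suc n} t t≡false rewrite t≡false zero = xorSum-false (t ∘ suc) (t≡false ∘ suc)

xorSum-single : ∀ {n} (t : Fin n → Bool) i → t i ≡ true → (∀ j → j ≢ i → t j ≡ false) → xorSum t ≡ true
xorSum-single t zero    ti others
  rewrite ti | xorSum-false (t ∘ suc) (λ j → others (suc j) λ ()) = refl
xorSum-single t (suc i) ti others
  rewrite others zero (λ ()) = xorSum-single (t ∘ suc) i ti (λ j j≢i → others (suc j) (j≢i ∘ Fin.suc-injective))

-- Ordered by μ, the rows in S are triangular, so a minimal row of a vanishing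
-- combination is isolated in its pivot column.
triangular⇒independent : ∀ {p q} (M : Matrix p q) {C S} (μ : Fin p → ℕ) →
  (∀ x → x ∈ S → ∃[ y ] y ∈ C × M x y ≡ true × (∀ x′ → x′ ∈ S → M x′ y ≡ true → x′ ≢ x → μ x′ < μ x)) →
  Independent M C S
triangular⇒independent M {C} {S} μ pivot (c , (x₀ , x₀∈c) , c⊆S , vanishes) =
  absent x₀ (<-wellFounded (μ x₀)) x₀∈c
  where
  absent : ∀ x → Acc _<_ (μ x) → ¬ x ∈ c
  absent x (acc below) x∈c with pivot x (c⊆S x∈c)
  ... | y , y∈C , Mxy , lower = contradiction (trans (sym sum≡true) (vanishes y y∈C)) λ ()
    where
    other : ∀ j → j ≢ x → lookup c j ∧ M j y ≡ false
    other j j≢x with lookup c j in c[j] | M j y in Mjy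
    ... | false | _     = refl
    ... | true  | false = refl
    ... | true  | true  =
      contradiction j∈c (absent j (below (lower j (c⊆S j∈c) Mjy j≢x)))
      where j∈c = lookup⇒[]= j c c[j]
    sum≡true : combination M c y ≡ true
    sum≡true = xorSum-single _ x (cong₂ _∧_ ([]=⇒lookup x∈c) Mxy) other

⌊⌋-true : ∀ {A : Set} (a? : Dec A) → A → ⌊ a? ⌋ ≡ true
⌊⌋-true (yes _) _ = refl
⌊⌋-true (no ¬a) a = contradiction a ¬a

true-⌊⌋ : ∀ {A : Set} (a? : Dec A) → ⌊ a? ⌋ ≡ true → A
true-⌊⌋ (yes a) _ = a

∈-tabulate⁺ : ∀ {n} {P : Fin n → Set} (P? : ∀ x → Dec (P x)) {x} → P x → x ∈ tabulate (λ x → ⌊ P? x ⌋)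
∈-tabulate⁺ P? {x} p = lookup⇒[]= x _ (trans (lookup∘tabulate _ x) (⌊⌋-true (P? x) p))

∈-tabulate⁻ : ∀ {n} {P : Fin n → Set} (P? : ∀ x → Dec (P x)) {x} → x ∈ tabulate (λ x → ⌊ P? x ⌋) → P x
∈-tabulate⁻ P? {x} x∈ = true-⌊⌋ (P? x) (trans (sym (lookup∘tabulate _ x)) ([]=⇒lookup x∈))

-- Chosen so that, for either orientation, a crossing edge descends from its end in the set to its
-- end outside. This is the order on the rows that is fed to `triangular⇒independent`.
height : ∀ {m} → Bool → Fin m → ℕ
height {m} true  a = m ℕ.∸ toℕ a
height     false a = toℕ a

Crossing-edge : ∀ {m} s {g : Fin m → Bool} {a} → Crossing s g a →
           g a ≡ true × (∃[ b ] g b ≡ false × Adj (cycle m) a b × height s b < height s a)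
Crossing-edge true {a = a} (b , next , before , after) =
  before a ℕ.≤-refl , b , after , ((λ { refl → ℕ.1+n≢n next }) , inj₁ (inj₁ next)) ,
  ℕ.∸-monoʳ-< (ℕ.≤-reflexive next) (ℕ.<⇒≤ (Fin.toℕ<n b))
Crossing-edge false {g = g} {a} (b , next , before , after) =
  flip after , b , flip (before b ℕ.≤-refl) , ((λ { refl → ℕ.1+n≢n next }) , inj₂ (inj₁ next)) ,
  ℕ.≤-reflexive next
  where
  flip : ∀ {x y} → not x ≡ y → x ≡ not y
  flip {x} eq = trans (sym (Bool.not-involutive x)) (cong not eq)

-- For a fixed sum n the product is concave in `w`, so between n/3 and 2n/3 it is smallest at the
-- ends, with value 2n²/9. The slacks of the two hypotheses turn this into an identity with surplus
-- `d * f`.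
balanced-product : ∀ {n} w w′ → w + w′ ≡ n → n ≤ 3 * w → 3 * w ≤ 2 * n → 2 * (n * n) ≤ 9 * (w * w′)
balanced-product w w′ refl n≤ ≤2n = go (3 * w ℕ.∸ (w + w′)) (2 * (w + w′) ℕ.∸ 3 * w)
    (ℕ.m+[n∸m]≡n n≤) (ℕ.m+[n∸m]≡n ≤2n)
  where
  -- With 3 w = n + d and 2 n = 3 w + f one has n = d + f, 3 w = 2 d + f and 3 w′ = d + 2 f.
  go : ∀ d f → w + w′ + d ≡ 3 * w → 3 * w + f ≡ 2 * (w + w′) → 2 * ((w + w′) * (w + w′)) ≤ 9 * (w * w′)
  go d f p q = begin
    2 * ((w + w′) * (w + w′))             ≡⟨ cong (λ n → 2 * (n * n)) n≡ ⟩
    2 * ((d + f) * (d + f))               ≤⟨ ℕ.m≤m+n _ (d * f) ⟩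
    2 * ((d + f) * (d + f)) + d * f       ≡⟨ i₁ d f ⟩
    (d + f + d) * (d + f + f)             ≡⟨ cong₂ _*_ 3w≡ 3w′≡ ⟩
    3 * w * (3 * w′)                      ≡⟨ i₂ w w′ ⟩
    9 * (w * w′)                          ∎
    where
    open ℕ.≤-Reasoning
    i₁ : ∀ d f → 2 * ((d + f) * (d + f)) + d * f ≡ (d + f + d) * (d + f + f)
    i₁ = solve-∀
    i₂ : ∀ w w′ → 3 * w * (3 * w′) ≡ 9 * (w * w′)
    i₂ = solve-∀
    i₃ : ∀ n d f → n + d + f ≡ n + (d + f)
    i₃ = solve-∀
    i₄ : ∀ n → 2 * n ≡ n + n
    i₄ = solve-∀
    n≡ : w + w′ ≡ d + f
    n≡ = sym (ℕ.+-cancelˡ-≡ (w + w′) _ _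
      (trans (sym (i₃ (w + w′) d f)) (trans (cong (_+ f) p) (trans q (i₄ (w + w′))))))
    3w≡ : d + f + d ≡ 3 * w
    3w≡ = trans (cong (_+ d) (sym n≡)) p
    3w′≡ : d + f + f ≡ 3 * w′
    3w′≡ = ℕ.+-cancelˡ-≡ (3 * w) _ _ (trans (e₁ (3 * w) (d + f) f)
      (trans (cong₂ _+_ q (sym n≡)) (e₂ w w′)))
      where
      e₁ : ∀ a b f → a + (b + f) ≡ a + f + b
      e₁ = solve-∀
      e₂ : ∀ w w′ → 2 * (w + w′) + (w + w′) ≡ 3 * w + 3 * w′
      e₂ = solve-∀

-- With n = m p the hypotheses chain to 8 n² ≤ 36 w w′ ≤ 9 m n σ ≤ 18 m n k ρ, from which the common
-- factor 2 m n is cancelled.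
combine-bounds : ∀ m p k ρ w w′ σ .{{_ : NonZero m}} .{{_ : NonZero p}} →
  2 * (m * p * (m * p)) ≤ 9 * (w * w′) → 4 * (w * w′) ≤ m * (m * p) * σ → σ ≤ k * (2 * ρ) →
  4 * p ≤ 9 * (k * ρ)
combine-bounds m p k ρ w w′ σ {{m≢0}} balanced iso σ≤ = ℕ.*-cancelˡ-≤ (2 * (m * (m * p))) {{nz}} (begin
  2 * (m * (m * p)) * (4 * p)            ≡⟨ i₁ m p ⟩
  4 * (2 * (m * p * (m * p)))            ≤⟨ ℕ.*-monoʳ-≤ 4 balanced ⟩
  4 * (9 * (w * w′))                     ≡⟨ i₂ (w * w′) ⟩
  9 * (4 * (w * w′))                     ≤⟨ ℕ.*-monoʳ-≤ 9 iso ⟩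
  9 * (m * (m * p) * σ)                  ≤⟨ ℕ.*-monoʳ-≤ 9 (ℕ.*-monoʳ-≤ (m * (m * p)) σ≤) ⟩
  9 * (m * (m * p) * (k * (2 * ρ)))      ≡⟨ i₃ (m * (m * p)) k ρ ⟩
  2 * (m * (m * p)) * (9 * (k * ρ))      ∎)
  where
  open ℕ.≤-Reasoning
  nz : NonZero (2 * (m * (m * p)))
  nz = ℕ.m*n≢0 2 (m * (m * p)) {{_}} {{ℕ.m*n≢0 m (m * p) {{m≢0}} {{ℕ.m*n≢0 m p}}}}
  i₁ : ∀ m p → 2 * (m * (m * p)) * (4 * p) ≡ 4 * (2 * (m * p * (m * p)))
  i₁ = solve-∀
  i₂ : ∀ a → 4 * (9 * a) ≡ 9 * (4 * a)
  i₂ = solve-∀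
  i₃ : ∀ a k ρ → 9 * (a * (k * (2 * ρ))) ≡ 2 * a * (9 * (k * ρ))
  i₃ = solve-∀

-- Cut-rank of vertex sets of the torus

module _ (m : ℕ) where
  open Grid m
  open Isoperimetry crossings crossings-cong crossings-line

  set-coord : ∀ k i x → set k i (coord k x i) x ≡ x
  set-coord k i x = coord-injective k agree
    where
    agree : ∀ j → coord k (set k i (coord k x i) x) j ≡ coord k x j
    agree j with j Fin.≟ i
    ... | yes refl = set-same k i (coord k x i) x
    ... | no  j≢i  = set-other k i (coord k x i) x j j≢i

  set-cong : ∀ k i a {x y} → (∀ j → j ≢ i → coord k x j ≡ coord k y j) → set k i a x ≡ set k i a y
  set-cong k i a {x} {y} same = coord-injective k agree
    where
    agree : ∀ j → coord k (set k i a x) j ≡ coord k (set k i a y) j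
    agree j with j Fin.≟ i
    ... | yes refl = trans (set-same k i a x) (sym (set-same k i a y))
    ... | no  j≢i  = trans (set-other k i a x j j≢i) (trans (same j j≢i) (sym (set-other k i a y j j≢i)))

  module _ (k : ℕ) (X : Subset (m ^ k)) where

    ℓ : Fin k → Fin (m ^ k) → Fin m → Bool
    ℓ = line k (lookup X)

    rows : Bool → Fin k → Subset (m ^ k)
    rows s i = tabulate (λ x → ⌊ crossing? s (ℓ i x) (coord k x i) ⌋)

    ∈-rows : ∀ s i {x} → x ∈ rows s i → Crossing s (ℓ i x) (coord k x i)
    ∈-rows s i = ∈-tabulate⁻ (λ x → crossing? s (ℓ i x) (coord k x i))

    rows⊆X : ∀ s i → rows s i ⊆ X
    rows⊆X s i {x} x∈ = lookup⇒[]= x X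
      (trans (cong (lookup X) (sym (set-coord k i x))) (proj₁ (Crossing-edge s (∈-rows s i x∈))))

    -- The pivot column of a row `x` is the other end `y` of its crossing edge, which lies outside
    -- `X` and lower than `x`. A row `x′` adjacent to `y` along direction `i` lies on the line of
    -- `x` and crosses there with the same orientation, so it is `x`; a row adjacent along another
    -- direction shares coordinate `i` with `y` and so is lower than `x`.
    rows-independent : ∀ s i → Independent (adjacencyMatrix (torus k m)) (∁ X) (rows s i)
    rows-independent s i = triangular⇒independent (adjacencyMatrix (torus k m)) (λ x → height s (coord k x i)) pivot
      where
      pivot : ∀ x → x ∈ rows s i → ∃[ y ] y ∈ ∁ X × adjacencyMatrix (torus k m) x y ≡ true ×
              (∀ x′ → x′ ∈ rows s i → adjacencyMatrix (torus k m) x′ y ≡ true → x′ ≢ x →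
               height s (coord k x′ i) < height s (coord k x i))
      pivot x x∈ with Crossing-edge s (∈-rows s i x∈)
      ... | _ , b , gb , adj , lower =
          y , lookup⇒[]= y (∁ X) (trans (lookup-map y not X) (cong not gb)) ,
          ⌊⌋-true (adj? (torus k m) x y)
            (i , subst (Adj (cycle m) (coord k x i)) (sym (set-same k i b x)) adj ,
             λ j j≢i → sym (set-other k i b x j j≢i)) ,
          λ x′ x′∈ Mx′y x′≢x → below x′ x′∈ x′≢x (true-⌊⌋ (adj? (torus k m) x′ y) Mx′y)
        where
        y = set k i b x
        below : ∀ x′ → x′ ∈ rows s i → x′ ≢ x → Adj (torus k m) x′ y →
                height s (coord k x′ i) < height s (coord k x i)
        below x′ x′∈ x′≢x (j , _ , same) with j Fin.≟ i
        ... | no j≢i = subst (λ a → height s a < height s (coord k x i))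
                         (sym (trans (same i (j≢i ∘ sym)) (set-same k i b x))) lower
        ... | yes refl = contradiction x′≡x x′≢x
          where
          sameLine : ∀ l → l ≢ i → coord k x′ l ≡ coord k x l
          sameLine l l≢i = trans (same l l≢i) (set-other k i b x l l≢i)
          x′ᵢ≡xᵢ : coord k x′ i ≡ coord k x i
          x′ᵢ≡xᵢ = Crossing-unique s
            (Crossing-cong s (λ a → cong (lookup X) (set-cong k i a sameLine)) (∈-rows s i x′∈)) (∈-rows s i x∈)
          x′≡x : x′ ≡ x
          x′≡x = trans (sym (set-coord k i x′))
            (trans (cong (λ a → set k i a x′) x′ᵢ≡xᵢ) (trans (set-cong k i _ sameLine) (set-coord k i x)))

    card-rows≤ : ∀ s i → sum (λ x → indicator s (ℓ i x) (coord k x i)) ≤ cutRank (torus k m) X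
    card-rows≤ s i = subst (_≤ cutRank (torus k m) X) (trans (card≡# (rows s i))
      (sum-cong-≗ {x = λ x → ⟦ lookup (rows s i) x ⟧} {y = λ x → indicator s (ℓ i x) (coord k x i)}
        (λ x → cong ⟦_⟧ (lookup∘tabulate _ x))))
      (independent⇒card≤rank (adjacencyMatrix (torus k m)) (rows⊆X s i) (rows-independent s i))

    -- In each of the `k` directions the crossings fall into two orientations, and each orientation
    -- yields one independent set of rows.
    weight≤ : sum (weight k (lookup X)) ≤ k * (2 * cutRank (torus k m) X)
    weight≤ = begin
      sum (weight k (lookup X))     ≤⟨ sum-mono each ⟩
      sum {k} (λ _ → 2 * ρ)         ≡⟨ sum-const k (2 * ρ) ⟩
      k * (2 * ρ)                   ∎
      where
      open ℕ.≤-Reasoning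
      ρ = cutRank (torus k m) X
      each : ∀ i → weight k (lookup X) i ≤ 2 * ρ
      each i = begin
        weight k (lookup X) i
          ≡⟨ ∑-distrib-+ (λ x → indicator true (ℓ i x) (coord k x i)) (λ x → indicator false (ℓ i x) (coord k x i)) ⟩
        _ ≤⟨ ℕ.+-mono-≤ (card-rows≤ true i) (card-rows≤ false i) ⟩
        ρ + ρ ≡⟨ cong (ρ +_) (sym (ℕ.+-identityʳ ρ)) ⟩
        2 * ρ ∎

  cutRank-lower-bound : ∀ k (X : Subset (m ^ suc k)) → .{{NonZero m}} →
    m ^ suc k ≤ 3 * card X → 3 * card X ≤ 2 * m ^ suc k →
    4 * m ^ k ≤ 9 * (suc k * cutRank (torus (suc k) m) X)
  cutRank-lower-bound k X {{m≢0}} n≤ ≤2n = combine-bounds m (m ^ k) (suc k) (cutRank (torus (suc k) m) X) (# f) (# (not ∘ f)) (sum (weight (suc k) f))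
    {{m≢0}} {{ℕ.m^n≢0 m k}}
    (balanced-product (# f) (# (not ∘ f)) (#+#not f)
      (subst (λ w → m ^ suc k ≤ 3 * w) (card≡# X) n≤) (subst (λ w → 3 * w ≤ 2 * m ^ suc k) (card≡# X) ≤2n))
    (isoperimetric (suc k) f)
    (weight≤ (suc k) X)
    where f = lookup X

-- Balanced edges of a rank-decomposition

card-∪≤ : ∀ {n} (p q : Subset n) → card (p ∪ q) ≤ card p + card q
card-∪≤ []            []            = z≤n
card-∪≤ (outside ∷ p) (outside ∷ q) = card-∪≤ p q
card-∪≤ (outside ∷ p) (inside  ∷ q) = ℕ.≤-trans (s≤s (card-∪≤ p q)) (ℕ.≤-reflexive (sym (ℕ.+-suc (card p) (card q))))
card-∪≤ (inside  ∷ p) (outside ∷ q) = s≤s (card-∪≤ p q)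
card-∪≤ (inside  ∷ p) (inside  ∷ q) = s≤s (ℕ.≤-trans (card-∪≤ p q) (ℕ.+-monoʳ-≤ (card p) (ℕ.n≤1+n (card q))))

empty⇒card≡0 : ∀ {n} (p : Subset n) → ¬ Nonempty p → card p ≡ 0
empty⇒card≡0 []            _  = refl
empty⇒card≡0 (outside ∷ p) ¬p = empty⇒card≡0 p (λ (x , x∈p) → ¬p (suc x , there x∈p))
empty⇒card≡0 (inside  ∷ p) ¬p = contradiction (zero , here) ¬p

subsingleton⇒card≤1 : ∀ {n} (p : Subset n) → (∀ {x y} → x ∈ p → y ∈ p → x ≡ y) → card p ≤ 1
subsingleton⇒card≤1 p same with nonempty? p
... | no  ¬p        = subst (_≤ 1) (sym (empty⇒card≡0 p ¬p)) z≤n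
... | yes (x , x∈p) = subst (card p ≤_) (∣⁅x⁆∣≡1 x)
  (p⊆q⇒∣p∣≤∣q∣ (λ y∈p → subst (_∈ ⁅ x ⁆) (same x∈p y∈p) (x∈⁅x⁆ x)))

elements : ∀ {n} → Subset n → List (Fin n)
elements []            = []
elements (outside ∷ p) = List.map suc (elements p)
elements (inside  ∷ p) = zero ∷ List.map suc (elements p)

length-elements : ∀ {n} (p : Subset n) → List.length (elements p) ≡ card p
length-elements []            = refl
length-elements (outside ∷ p) = trans (List.length-map suc (elements p)) (length-elements p)
length-elements (inside  ∷ p) = cong suc (trans (List.length-map suc (elements p)) (length-elements p))

∈-elements⁺ : ∀ {n} {p : Subset n} {x} → x ∈ p → x List.∈ elements p
∈-elements⁺ {p = inside  ∷ p} here        = here refl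
∈-elements⁺ {p = outside ∷ p} (there x∈p) = List.∈-map⁺ suc (∈-elements⁺ x∈p)
∈-elements⁺ {p = inside  ∷ p} (there x∈p) = there (List.∈-map⁺ suc (∈-elements⁺ x∈p))

∈-elements⁻ : ∀ {n} (p : Subset n) {x} → x List.∈ elements p → x ∈ p
∈-elements⁻ (outside ∷ p) x∈ with List.∈-map⁻ suc x∈
... | y , y∈ , refl = there (∈-elements⁻ p y∈)
∈-elements⁻ (inside ∷ p) (here refl) = here
∈-elements⁻ (inside ∷ p) (there x∈) with List.∈-map⁻ suc x∈
... | y , y∈ , refl = there (∈-elements⁻ p y∈)

x∈p-y⇒x≢y : ∀ {n} (p : Subset n) {x y} → x ∈ p - y → x ≢ y
x∈p-y⇒x≢y (outside ∷ p) {suc x} {suc .x} (there x∈) refl = x∈p-y⇒x≢y p x∈ refl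
x∈p-y⇒x≢y (inside  ∷ p) {suc x} {suc .x} (there x∈) refl = x∈p-y⇒x≢y p x∈ refl

-- Walks and simple paths in acyclic graphs

module _ {n} {R : Rel (Fin n) 0ℓ} where

  open DecMembership (Fin._≟_ {n}) using () renaming (_∈?_ to _∈ₗ?_)

  data Path : Fin n → List (Fin n) → Fin n → Set where
    []  : ∀ {x} → Path x [] x
    _∷_ : ∀ {x y z vs} → R x y → Path y vs z → Path x (y ∷ vs) z

  suffix : ∀ {x y z vs} → Path y vs z → Unique (y ∷ vs) → x List.∈ y ∷ vs →
           ∃[ ws ] Path x ws z × Unique (x ∷ ws)
  suffix p       u       (here refl) = _ , p , u
  suffix (_ ∷ p) (_ ∷ u) (there x∈)  = suffix p u x∈

  -- Loops are erased from the end: if `x` already occurs on the simple path that it is to be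
  -- prepended to, only the part of that path from `x` on is kept.
  simplePath : ∀ {x y} → Star R x y → ∃[ vs ] Path x vs y × Unique (x ∷ vs)
  simplePath ε = [] , [] , All.[] ∷ []
  simplePath {x} (_◅_ {j = z} r rs) with simplePath rs
  ... | vs , p , u with x ∈ₗ? (z ∷ vs)
  ...   | yes x∈ = suffix p u x∈
  ...   | no  x∉ = z ∷ vs , r ∷ p , ¬Any⇒All¬ _ x∉ ∷ u

  path⇒linked : ∀ {Q : Rel (Fin n) 0ℓ} {x y vs w} → (∀ {u v} → R u v → Q u v) →
                Path x vs y → Q y w → Linked Q (x ∷ vs ++ [ w ])
  path⇒linked f []      q = q ∷ [-]
  path⇒linked f (r ∷ p) q = f r ∷ path⇒linked f p q

module _ {n} {T : Graph n} where

  -- A simple path from `a` to `s` avoiding their edge would close up with it to a cycle. Length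
  -- zero would give a loop and length one the removed edge itself, so such a path has the three
  -- vertices that `IsCycle` asks for.
  acyclic⇒separated : Acyclic T → ∀ {a s} → Adj T a s → ¬ Reachable (removeEdge T a s) a s
  acyclic⇒separated acyclic {a} {s} as walk with simplePath walk
  ... | []          , []               , _ = irrefl T refl as
  ... | _ ∷ []      , (_ , ¬same) ∷ [] , _ = ¬same (inj₁ (refl , refl))
  ... | v ∷ w ∷ vs  , p                , u =
    acyclic a (v ∷ w ∷ vs) (s≤s (s≤s z≤n) , u , path⇒linked proj₁ p (symm T as))

  -- Cut a walk from s at its last visit to s.
  branch : ∀ {s t v} → Reachable (removeEdge T s t) s v →
           v ≡ s ⊎ ∃[ a ] Adj T s a × a ≢ t × Reachable (removeEdge T a s) a v
  branch {s} {t} {v} walk with go walk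
    where
    Avoiding : Rel (Fin n) 0ℓ
    Avoiding x y = Adj T x y × x ≢ s × y ≢ s

    avoid : ∀ a {x} → Star Avoiding x v → Reachable (removeEdge T a s) x v
    avoid a = Star.map λ { (xy , x≢s , y≢s) →
      xy , λ { (inj₁ (_ , y≡s)) → y≢s y≡s ; (inj₂ (x≡s , _)) → x≢s x≡s } }

    go : ∀ {x} → Reachable (removeEdge T s t) x v →
         (v ≡ s ⊎ ∃[ a ] Adj T s a × a ≢ t × Reachable (removeEdge T a s) a v) ⊎ (x ≢ s × Star Avoiding x v)
    go ε with v Fin.≟ s
    ... | yes v≡s = inj₁ (inj₁ v≡s)
    ... | no  v≢s = inj₂ (v≢s , ε)
    go (_◅_ {x} {y} (xy , ¬same) rest) with go rest
    ... | inj₁ found = inj₁ found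
    ... | inj₂ (y≢s , tail) with x Fin.≟ s
    -- This is the last departure from `s`; it does not lead to `t`, because the walk never uses the
    -- removed edge.
    ...   | yes refl = inj₁ (inj₂ (y , xy , (λ { refl → ¬same (inj₁ (refl , refl)) }) , avoid y tail))
    ...   | no  x≢s  = inj₂ (x≢s , (xy , x≢s , y≢s) ◅ tail)
  ... | inj₁ found      = found
  ... | inj₂ (s≢s , _)  = contradiction refl s≢s

  -- By acyclicity a walk from `a` that avoids the edge between `a` and `s` never meets `s`, hence
  -- uses no edge at `s`, in particular not the one to `t`. The step from `s` to `a` is then put in
  -- front.
  branch⊆ : Acyclic T → ∀ {s t a v} → Adj T s a → a ≢ t →
            Reachable (removeEdge T a s) a v → Reachable (removeEdge T s t) s v
  branch⊆ acyclic {s} {t} {a} {v} sa a≢t walk = (sa , first) ◅ go ε walk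
    where
    first : ¬ ((s ≡ s × a ≡ t) ⊎ (s ≡ t × a ≡ s))
    first (inj₁ (_ , a≡t)) = a≢t a≡t
    first (inj₂ (_ , refl)) = irrefl T refl sa
    avoidsS : ∀ {x} → Reachable (removeEdge T a s) a x → x ≢ s
    avoidsS prefix refl = acyclic⇒separated acyclic (symm T sa) prefix
    go : ∀ {x} → Reachable (removeEdge T a s) a x → Reachable (removeEdge T a s) x v →
         Reachable (removeEdge T s t) x v
    go prefix ε = ε
    go prefix (r@(xy , _) ◅ rest) = (xy , λ
      { (inj₁ (x≡s , _)) → avoidsS prefix x≡s
      ; (inj₂ (_ , y≡s)) → avoidsS (prefix ◅◅ r ◅ ε) y≡s }) ◅ go (prefix ◅◅ r ◅ ε) rest

  -- Read the walk backwards from `v` up to the first vertex that is `s` or `t`: the part from there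
  -- to `v` does not use the edge between them.
  eitherSide : ∀ {s t v} → Reachable T s v → Reachable (removeEdge T s t) s v ⊎ Reachable (removeEdge T t s) t v
  eitherSide {s} {t} {v} walk with go walk
    where
    swapEdge : ∀ {x} → Reachable (removeEdge T s t) x v → Reachable (removeEdge T t s) x v
    swapEdge = Star.map λ { (xy , ¬same) → xy , λ { (inj₁ e) → ¬same (inj₂ e) ; (inj₂ e) → ¬same (inj₁ e) } }
    go : ∀ {x} → Reachable T x v →
         (Reachable (removeEdge T s t) s v ⊎ Reachable (removeEdge T t s) t v) ⊎ Reachable (removeEdge T s t) x v
    go ε = inj₂ ε
    go (_◅_ {x} {y} xy rest) with go rest
    ... | inj₁ found = inj₁ found
    ... | inj₂ tail with y Fin.≟ s | y Fin.≟ t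
    ...   | yes refl | _        = inj₁ (inj₁ tail)
    ...   | no _     | yes refl = inj₁ (inj₂ (swapEdge tail))
    ...   | no y≢s   | no y≢t   =
      inj₂ ((xy , λ { (inj₁ (_ , y≡t)) → y≢t y≡t ; (inj₂ (_ , y≡s)) → y≢s y≡s }) ◅ tail)
  ... | inj₁ found = found
  ... | inj₂ found = inj₁ found

-- Descent to an edge with balanced sides

module _ {n} {G : Graph n} (D : RankDecomposition G) where
  open RankDecomposition D hiding (width)
  open IsTree isTree

  private
    T = tree
    Edge = Fin nodes × Fin nodes

  component : Edge → Subset nodes
  component (s , t) = tabulate (λ v → ⌊ reachable? (removeEdge T s t) s v ⌋)

  ∈-component⁻ : ∀ s t {v} → v ∈ component (s , t) → Reachable (removeEdge T s t) s v
  ∈-component⁻ s t = ∈-tabulate⁻ (λ v → reachable? (removeEdge T s t) s v)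

  ∈-component⁺ : ∀ s t {v} → Reachable (removeEdge T s t) s v → v ∈ component (s , t)
  ∈-component⁺ s t = ∈-tabulate⁺ (λ v → reachable? (removeEdge T s t) s v)

  ∈-side⁻ : ∀ s t {x} → x ∈ side (s , t) → Reachable (removeEdge T s t) s (leaf x)
  ∈-side⁻ s t = ∈-tabulate⁻ (λ x → reachable? (removeEdge T s t) s (leaf x))

  ∈-side⁺ : ∀ s t {x} → Reachable (removeEdge T s t) s (leaf x) → x ∈ side (s , t)
  ∈-side⁺ s t = ∈-tabulate⁺ (λ x → reachable? (removeEdge T s t) s (leaf x))

  leaf-injective : ∀ {x y} → leaf x ≡ leaf y → x ≡ y
  leaf-injective {x} {y} eq = Bijection.injective leaves (lift (Bijection.to leaves x) (Bijection.to leaves y) eq)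
    where
    lift : (u v : Leaf T) → proj₁ u ≡ proj₁ v → u ≡ v
    lift (_ , p) (_ , q) refl = cong (_ ,_) (ℕ.≡-irrelevant p q)

  -- The new component lies in the old one by `branch⊆` and misses `s` by `acyclic⇒separated`.
  -- Counting nodes instead of leaves makes the strictness immediate, and this is the measure by
  -- which the descent terminates.
  component-shrinks : ∀ {s t a} → Adj T s a → a ≢ t → card (component (a , s)) < card (component (s , t))
  component-shrinks {s} {t} {a} sa a≢t = p⊂q⇒∣p∣<∣q∣
    ( (λ v∈ → ∈-component⁺ s t (branch⊆ {T = T} acyclic sa a≢t (∈-component⁻ a s v∈)))
    , s , ∈-component⁺ s t ε , λ s∈ → acyclic⇒separated {T = T} acyclic (symm T sa) (∈-component⁻ a s s∈))

  otherNeighbours : Edge → Subset nodes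
  otherNeighbours (s , t) = neighbours T s - t

  ∈-otherNeighbours⁻ : ∀ s t {a} → a ∈ otherNeighbours (s , t) → Adj T s a × a ≢ t
  ∈-otherNeighbours⁻ s t {a} a∈ =
    ∈-tabulate⁻ (adj? T s) (p─q⊆p (neighbours T s) ⁅ t ⁆ a∈) , x∈p-y⇒x≢y (neighbours T s) a∈

  ∈-otherNeighbours⁺ : ∀ s t {a} → Adj T s a → a ≢ t → a ∈ otherNeighbours (s , t)
  ∈-otherNeighbours⁺ s t sa a≢t = x∈p∧x≢y⇒x∈p-y (∈-tabulate⁺ (adj? T s) sa) a≢t

  otherNeighbours<degree : ∀ {s t} → Adj T s t → card (otherNeighbours (s , t)) < degree T s
  otherNeighbours<degree {s} {t} st = x∈p⇒∣p-x∣<∣p∣ (∈-tabulate⁺ (adj? T s) st)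

  -- At a node of degree one `t` is the only neighbour, so `branch` leaves no leaf but `s` itself,
  -- and `leaf` is injective.
  side-leaf : ∀ {s t} → Adj T s t → degree T s ≡ 1 → card (side (s , t)) ≤ 1
  side-leaf {s} {t} st deg = subsingleton⇒card≤1 (side (s , t))
    (λ x∈ y∈ → leaf-injective (trans (isS x∈) (sym (isS y∈))))
    where
    none : ∀ {a} → a ∉ otherNeighbours (s , t)
    none {a} a∈ = ℕ.<⇒≱ (subst (card (otherNeighbours (s , t)) <_) deg (otherNeighbours<degree st))
      (subst (_≤ card (otherNeighbours (s , t))) (∣⁅x⁆∣≡1 a)
        (p⊆q⇒∣p∣≤∣q∣ {p = ⁅ a ⁆} (λ y∈ → subst (_∈ otherNeighbours (s , t)) (sym (x∈⁅y⁆⇒x≡y a y∈)) a∈)))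
    isS : ∀ {x} → x ∈ side (s , t) → leaf x ≡ s
    isS x∈ with branch {T = T} (∈-side⁻ s t x∈)
    ... | inj₁ eq = eq
    ... | inj₂ (a , sa , a≢t , _) = contradiction (∈-otherNeighbours⁺ s t sa a≢t) none

  -- A node of degree 3 is not a leaf, so every leaf on this side lies beyond some neighbour other
  -- than `t`.
  side-branch : ∀ {s t} → degree T s ≡ 3 → ∀ {x} → x ∈ side (s , t) →
                ∃[ a ] a List.∈ elements (otherNeighbours (s , t)) × x ∈ side (a , s)
  side-branch {s} {t} deg {x} x∈ with branch {T = T} (∈-side⁻ s t x∈)
  ... | inj₁ eq = contradiction
    (trans (sym (proj₂ (Bijection.to leaves x))) (trans (cong (degree T) eq) deg)) λ ()
  ... | inj₂ (a , sa , a≢t , walk) =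
    a , ∈-elements⁺ (∈-otherNeighbours⁺ s t sa a≢t) , ∈-side⁺ a s walk

  -- At most two branches cover the side. If each held fewer than n/3 vertices, the side would hold
  -- fewer than 2n/3.
  heavyBranch : ∀ {s t} → Adj T s t → degree T s ≡ 3 → 2 * n < 3 * card (side (s , t)) →
                ∃[ a ] Adj T s a × a ≢ t × n ≤ 3 * card (side (a , s))
  heavyBranch {s} {t} st deg heavy =
    go (elements (otherNeighbours (s , t)))
       (ℕ.≤-trans (ℕ.≤-reflexive (length-elements (otherNeighbours (s , t))))
                  (ℕ.≤-pred (subst (card (otherNeighbours (s , t)) <_) deg (otherNeighbours<degree st))))
       (λ a∈ → ∈-otherNeighbours⁻ s t (∈-elements⁻ (otherNeighbours (s , t)) a∈))
       (side-branch deg)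
    where
    w : Edge → ℕ
    w = card ∘ side
    go : ∀ as → List.length as ≤ 2 → (∀ {a} → a List.∈ as → Adj T s a × a ≢ t) →
         (∀ {x} → x ∈ side (s , t) → ∃[ a ] a List.∈ as × x ∈ side (a , s)) →
         ∃[ a ] Adj T s a × a ≢ t × n ≤ 3 * w (a , s)
    -- The list is only known to have at most two entries, so lengths zero and one occur as cases
    -- too; here the side would be empty.
    go [] _ _ cover = contradiction (subst (λ w → 2 * n < 3 * w) (empty⇒card≡0 _
      (λ (x , x∈) → contradiction (proj₁ (proj₂ (cover x∈))) λ ())) heavy) λ ()
    go (a ∷ []) _ isNbr cover with isNbr (here refl)
    ... | sa , a≢t = a , sa , a≢t , (begin
        n               ≤⟨ ℕ.m≤n*m n 2 ⟩
        2 * n           <⟨ heavy ⟩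
        3 * w (s , t)   ≤⟨ ℕ.*-monoʳ-≤ 3 (p⊆q⇒∣p∣≤∣q∣ (λ x∈ → inA (cover x∈))) ⟩
        3 * w (a , s)   ∎)
      where
      open ℕ.≤-Reasoning
      inA : ∀ {x} → (∃[ c ] c List.∈ List.[ a ] × x ∈ side (c , s)) → x ∈ side (a , s)
      inA (_ , here refl , x∈) = x∈
    go (a ∷ b ∷ []) _ isNbr cover with n ℕ.≤? 3 * w (a , s) | isNbr (here refl) | isNbr (there (here refl))
    ... | yes n≤ | sa , a≢t | _        = a , sa , a≢t , n≤
    ... | no  n≰ | _        | sb , b≢t = b , sb , b≢t , ℕ.<⇒≤ (ℕ.+-cancelˡ-< n _ _ (begin-strict
        n + n                          ≡⟨ cong (n +_) (sym (ℕ.+-identityʳ n)) ⟩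
        2 * n                          <⟨ heavy ⟩
        3 * w (s , t)                  ≤⟨ ℕ.*-monoʳ-≤ 3 (ℕ.≤-trans (p⊆q⇒∣p∣≤∣q∣ (λ x∈ → inAB (cover x∈)))
                                                                  (card-∪≤ (side (a , s)) (side (b , s)))) ⟩
        3 * (w (a , s) + w (b , s))    ≡⟨ ℕ.*-distribˡ-+ 3 (w (a , s)) (w (b , s)) ⟩
        3 * w (a , s) + 3 * w (b , s)  <⟨ ℕ.+-monoˡ-< (3 * w (b , s)) (ℕ.≰⇒> n≰) ⟩
        n + 3 * w (b , s)              ∎))
      where
      open ℕ.≤-Reasoning
      inAB : ∀ {x} → (∃[ c ] c List.∈ (a ∷ b ∷ []) × x ∈ side (c , s)) → x ∈ side (a , s) ∪ side (b , s)
      inAB (_ , here refl , x∈)         = x∈p∪q⁺ (inj₁ x∈)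
      inAB (_ , there (here refl) , x∈) = x∈p∪q⁺ (inj₂ x∈)
    go (_ ∷ _ ∷ _ ∷ _) (s≤s (s≤s ()))

  Balanced : Edge → Set
  Balanced (s , t) = Adj T s t × n ≤ 3 * card (side (s , t)) × 3 * card (side (s , t)) ≤ 2 * n

  -- If the side exceeds 2n/3, then `s` is not a leaf, so it has degree 3 and some branch still
  -- holds n/3 of the vertices. Moving there keeps the lower bound while the component shrinks.
  descend : 2 ≤ n → ∀ s t → Acc _<_ (card (component (s , t))) → Adj T s t →
            n ≤ 3 * card (side (s , t)) → ∃ Balanced
  descend 2≤n s t (acc smaller) st n≤ with 3 * card (side (s , t)) ℕ.≤? 2 * n | subcubic s
  ... | yes ≤2n | _        = (s , t) , st , n≤ , ≤2n
  ... | no  ≰2n | inj₁ deg = contradiction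
    -- The side of a leaf has at most one vertex, and 3 ≤ 4 ≤ 2n.
    (ℕ.≤-trans (ℕ.*-monoʳ-≤ 3 (side-leaf st deg)) (ℕ.≤-trans (ℕ.n≤1+n 3) (ℕ.*-monoʳ-≤ 2 2≤n))) ≰2n
  ... | no  ≰2n | inj₂ deg with heavyBranch st deg (ℕ.≰⇒> ≰2n)
  ...   | a , sa , a≢t , n≤′ = descend 2≤n a s (smaller (component-shrinks sa a≢t)) (symm T sa) n≤′

  someEdge : ∃[ s ] ∃[ t ] Adj T s t
  someEdge with nonempty? (neighbours T s₀)
    where s₀ = fromℕ< (ℕ.<⇒≤ 2≤nodes)
  ... | yes (t , t∈) = _ , t , ∈-tabulate⁻ (adj? T _) t∈
  ... | no  none     = contradiction (empty⇒card≡0 (neighbours T _) none) (positive _)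
    where
    positive : ∀ s → degree T s ≢ 0
    positive s deg≡0 with subcubic s
    ... | inj₁ deg = contradiction (trans (sym deg) deg≡0) λ ()
    ... | inj₂ deg = contradiction (trans (sym deg) deg≡0) λ ()

  sides-cover : ∀ s t → n ≤ card (side (s , t)) + card (side (t , s))
  sides-cover s t = begin
    n                                           ≡⟨ sym (∣⊤∣≡n n) ⟩
    card (⊤ {n})                                ≤⟨ p⊆q⇒∣p∣≤∣q∣ {p = ⊤} (λ {x} _ → x∈p∪q⁺ (inSides x)) ⟩
    card (side (s , t) ∪ side (t , s))          ≤⟨ card-∪≤ (side (s , t)) (side (t , s)) ⟩
    card (side (s , t)) + card (side (t , s))   ∎
    where
    open ℕ.≤-Reasoning
    inSides : ∀ x → x ∈ side (s , t) ⊎ x ∈ side (t , s)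
    inSides x with eitherSide {T = T} {s} {t} (connected s (leaf x))
    ... | inj₁ walk = inj₁ (∈-side⁺ s t walk)
    ... | inj₂ walk = inj₂ (∈-side⁺ t s walk)

  -- The two sides of any edge cover all vertices, so one of its two orientations has a side of at
  -- least n/3 from which the descent can start.
  balancedEdge : 2 ≤ n → ∃ Balanced
  balancedEdge 2≤n with someEdge
  ... | s , t , st with n ℕ.≤? 3 * card (side (s , t))
  ...   | yes n≤ = descend 2≤n s t (<-wellFounded _) st n≤
  ...   | no  n≰ = descend 2≤n t s (<-wellFounded _) (symm T st) (ℕ.+-cancelˡ-≤ n _ _ (begin
      n + n                                                 ≤⟨ ℕ.+-monoʳ-≤ n (ℕ.m≤m+n n _) ⟩
      3 * n                                                 ≤⟨ ℕ.*-monoʳ-≤ 3 (sides-cover s t) ⟩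
      3 * (card (side (s , t)) + card (side (t , s)))       ≡⟨ ℕ.*-distribˡ-+ 3 (card (side (s , t))) _ ⟩
      3 * card (side (s , t)) + 3 * card (side (t , s))     ≤⟨ ℕ.+-monoˡ-≤ _ (ℕ.<⇒≤ (ℕ.≰⇒> n≰)) ⟩
      n + 3 * card (side (t , s))                           ∎))
    where open ℕ.≤-Reasoning

  cutRank≤width : ∀ {s t} → Adj T s t → cutRank G (side (s , t)) ≤ width D
  cutRank≤width {s} {t} st = ∈-max (List.∈-map⁺ (cutRank G ∘ side)
    (List.∈-filter⁺ (λ (s , t) → adj? T s t) (List.∈-cartesianProduct⁺ (List.∈-allFin s) (List.∈-allFin t)) st))

width-lower-bound : ∀ k m → 2 ≤ m → (D : RankDecomposition (torus (suc k) m)) → 4 * m ^ k ≤ 9 * (suc k * width D)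
width-lower-bound k m 2≤m D = fromBalanced (balancedEdge D (ℕ.≤-trans 2≤m (ℕ.m≤m*n m (m ^ k) {{ℕ.m^n≢0 m k {{m≢0}}}})))
  where
  m≢0 : NonZero m
  m≢0 = >-nonZero (ℕ.<⇒≤ 2≤m)
  fromBalanced : ∃ (Balanced D) → 4 * m ^ k ≤ 9 * (suc k * width D)
  fromBalanced ((s , t) , st , n≤3w , 3w≤2n) = ℕ.≤-trans
    (cutRank-lower-bound m k (RankDecomposition.side D (s , t)) {{m≢0}} n≤3w 3w≤2n)
    (ℕ.*-monoʳ-≤ 9 (ℕ.*-monoʳ-≤ (suc k) (cutRank≤width D st)))

-- The real lower bound and its order of growth

open import Data.Nat.Properties using (<⇒≤)
open import Data.Integer.Base using (+_)
open import Data.Rational.Base using (_/_)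

scaled-constant : (k M : ℕ) .{{_ : NonZero k}} → ℝ
scaled-constant k M = (e *ᴿ ln2 *ᴿ fromℚ (+ 1 / 5)) *ᴿ fromℚ (+ M / k)

-- As (e ln 2)/5 is eventually approximated by rationals at most 4/9, the left side is eventually at
-- most 4M/(9k); the hypothesis compares this with `r` after clearing denominators.
scaled-constant≤ : ∀ k M r .{{_ : NonZero k}} → 4 * M ≤ 9 * (k * r) → scaled-constant k M ≤ᴿ fromℕ r
scaled-constant≤ k@(suc _) M r 4M≤9kr = ≤ᴿ-eventually (scaled-constant k M) (fromℕ r)
  (eventually-map (λ { i (_ , upper) → begin
    seq e i ℚ.* seq ln2 i ℚ.* (+ 1 / 5) ℚ.* (+ M / k)
      ≤⟨ ℚ.*-monoʳ-≤-nonNeg (+ M / k) {{ℚ.nonNegative (/-nonNeg M k)}} upper ⟩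
    (+ 4 / 9) ℚ.* (+ M / k)    ≡⟨ /-* 4 9 M k ⟩
    + (4 * M) / (9 * k)        ≤⟨ /-mono {4 * M} {r} (9 * k) 1 le ⟩
    + r / 1                    ∎ }) constant-bounds)
  where
  open ℚ.≤-Reasoning
  le : 4 * M * 1 ≤ r * (9 * k)
  le = ℕ.≤-trans (ℕ.≤-reflexive (ℕ.*-identityʳ (4 * M))) (ℕ.≤-trans 4M≤9kr (ℕ.≤-reflexive (rearranged k r)))
    where
    rearranged : ∀ k r → 9 * (k * r) ≡ r * (9 * k)
    rearranged = solve-∀

-- Since (m^(k+1))^k = (m^k)^(k+1), the root is that of an exact power, and its approximations stay
-- at or below m^k. In the constant, 1/10 is the lower bound on (e ln 2)/5 and 1/(k+1) is the
-- divisor present in the bound.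
scaled-constant≥ : ∀ k m → fromℚ (+ 1 / (10 * suc k)) *ᴿ ((m ^ suc k) ^[ k / suc k ]) ≤ᴿ scaled-constant (suc k) (m ^ k)
scaled-constant≥ k m = ≤ᴿ-eventually (fromℚ c *ᴿ ((m ^ suc k) ^[ k / suc k ])) (scaled-constant (suc k) M)
  (eventually-map (λ { j (lower , _) → begin
    c ℚ.* seq (root (suc k) ((m ^ suc k) ^ k)) j
      ≡⟨ cong (λ N → c ℚ.* seq (root (suc k) N) j) exponents ⟩
    c ℚ.* seq (root (suc k) (M ^ suc k)) j
      ≤⟨ ℚ.*-monoˡ-≤-nonNeg c {{ℚ.nonNegative (/-nonNeg 1 (10 * suc k))}} (root-upper k M j) ⟩
    c ℚ.* (+ M / 1)                ≡⟨ /-* 1 (10 * suc k) M 1 ⟩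
    + (1 * M) / (10 * suc k * 1)   ≤⟨ /-mono {1 * M} {1 * M} (10 * suc k * 1) (10 * suc k)
                                        (ℕ.≤-reflexive (cong (1 * M *_) (sym (ℕ.*-identityʳ (10 * suc k))))) ⟩
    + (1 * M) / (10 * suc k)       ≡⟨ sym (/-* 1 10 M (suc k)) ⟩
    (+ 1 / 10) ℚ.* (+ M / suc k)
      ≤⟨ ℚ.*-monoʳ-≤-nonNeg (+ M / suc k) {{ℚ.nonNegative (/-nonNeg M (suc k))}} lower ⟩
    seq e j ℚ.* seq ln2 j ℚ.* (+ 1 / 5) ℚ.* (+ M / suc k) ∎ }) constant-bounds)
  where
  open ℚ.≤-Reasoning
  M = m ^ k
  c = + 1 / (10 * suc k)
  exponents : (m ^ suc k) ^ k ≡ M ^ suc k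
  exponents = trans (ℕ.^-*-assoc m (suc k) k)
    (trans (cong (m ^_) (ℕ.*-comm (suc k) k)) (sym (ℕ.^-*-assoc m k (suc k))))

corollary7 : (k : ℕ) (2≤k : 2 ≤ k) →
    let instance
          k≢0 : NonZero k
          k≢0 = >-nonZero (<⇒≤ 2≤k)
        side = λ (l : ℕ) → 2 * l
        n = λ l → side l ^ k
        lowerBound = λ l → (e *ᴿ ln2 *ᴿ fromℚ (+ 1 / 5)) *ᴿ fromℚ (+ (side l ^ (k ∸ 1)) / k)
    in (∀ l → 3 < l → ∀ rw → IsRankWidth (torus k (side l)) rw → lowerBound l ≤ᴿ fromℕ rw)
     × (lowerBound =Ω λ l → n l ^[ k ∸ 1 / k ])
corollary7 (suc k) 2≤k =
  -- The width bound is applied to the decomposition `D` that attains `rw`.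
  (λ { l 3<l rw ((D , refl) , _) → scaled-constant≤ (suc k) ((2 * l) ^ k) rw
       (width-lower-bound k (2 * l) (ℕ.*-monoʳ-≤ 2 (ℕ.≤-trans (s≤s z≤n) 3<l)) D) })
  , + 1 / (10 * suc k) , ℚ.positive⁻¹ _ {{ℚ.normalize-pos 1 (10 * suc k)}}
  , 0 , λ l _ → scaled-constant≥ k (2 * l)
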